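{- Let $\mathcal{H}$ be a hypersequent of the calculus $\mathrm{G}^1\text{\L}\forall$. If $\mathcal{H}$ is provable in $\mathrm{G}^1\text{\L}\forall$, then $\mathcal{H}$ is provable in $\mathrm{G}^3\text{\L}\forall$.
   Context: Syntax. Fix a signature of predicate and function symbols of arbitrary nonnegative arities that includes a countable set of nullary function symbols called parameters (there are infinitely many of them). Terms are standard. Atomic $\mathrm{RPL}\forall$-formulas are $P(t_1,\dots,t_n)$ ($P$ a predicate symbol, $t_i$ terms) and truth constants $\bar r$ for rational $r\in[0,1]$. $\mathrm{RPL}\forall$-formulas are built from these using the logical symbols $\to$ (binary), $\forall$, $\exists$. $[A]^x_t$ is the result of substituting $t$ for all free occurrences of the variable $x$ in $A$. In addition there are countably (infinitely) many semipropositional variables of type 1, and countably (infinitely) many semipropositional variables of type 0. A formula is an $\mathrm{RPL}\forall$-formula or a semipropositional variable (so semipropositional variables do not occur inside compound formulas). An atom is an atomic $\mathrm{RPL}\forall$-formula or a semipropositional variable. A sequent $\Gamma\Rightarrow\Delta$ is an ordered pair of finite multisets of formulas (its members); it is atomic if all its members are atoms. A hypersequent $S_1\,|\,\cdots\,|\,S_n$ is a finite multiset of sequents. A hypersequent of $\mathrm{G}^1\text{\L}\forall$ is a hypersequent containing no semipropositional variables of type 0. Semantics (needed for axioms). An hs-interpretation $M=\langle\mathcal{D},\mu\rangle$ has a nonempty domain $\mathcal{D}$; $\mu$ interprets $n$-ary function symbols by functions $\mathcal{D}^n\to\mathcal{D}$, $n$-ary predicate symbols by maps $\mathcal{D}^n\to[0,1]$,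 each semipropositional variable of type 0 by a real in $[0,+\infty)$, and each of type 1 by a real in $(-\infty,1]$. A valuation $\nu$ maps individual variables to $\mathcal{D}$. For atoms: $|\bar r|_{M,\nu}=r$; $|P(t_1,\dots,t_n)|_{M,\nu}=\mu(P)(|t_1|_{M,\nu},\dots,|t_n|_{M,\nu})$; a semipropositional variable has the value given by $\mu$. For a finite multiset $\Gamma$ of atoms, $|\Gamma|_{M,\nu}=\sum_{F\in\Gamma}(|F|_{M,\nu}-1)$ (with multiplicity; $0$ if $\Gamma$ is empty). An atomic sequent $\Gamma\Rightarrow\Delta$ is true under $M,\nu$ if $|\Delta|_{M,\nu}-|\Gamma|_{M,\nu}\geqslant0$. Calculus $\mathrm{G}^3\text{\L}\forall$. Axioms: all hypersequents in which, for every hs-interpretation $M$ and valuation $\nu$, there is an atomic sequent true under $M$ and $\nu$. Rules (premises / conclusion), with $A,B$ $\mathrm{RPL}\forall$-formulas, $\Gamma,\Delta$ finite multisets of formulas, $\mathcal{G}$ a (possibly empty) hypersequent: $(\to\Rightarrow)^3$: $\mathcal{G}\,|\,\Gamma,\mathfrak{p}\Rightarrow\Delta\,|\,B\Rightarrow\mathfrak{p},A$ / $\mathcal{G}\,|\,\Gamma,A\to B\Rightarrow\Delta$; $(\Rightarrow\to)^3$: $\mathcal{G}\,|\,\Gamma\Rightarrow\Delta$ and $\mathcal{G}\,|\,\Gamma,A\Rightarrow B,\Delta$ / $\mathcal{G}\,|\,\Gamma\Rightarrow A\to B,\Delta$; $(\forall\Rightarrow)^3$: $\mathcal{G}\,|\,\Gamma,\mathfrak{p}\Rightarrow\Delta\,|\,\forall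 xA\Rightarrow\mathfrak{p}\,|\,[A]^x_t\Rightarrow\mathfrak{p}$ / $\mathcal{G}\,|\,\Gamma,\forall xA\Rightarrow\Delta$; $(\Rightarrow\forall)^3$: $\mathcal{G}\,|\,\Gamma\Rightarrow[A]^x_a,\Delta$ / $\mathcal{G}\,|\,\Gamma\Rightarrow\forall xA,\Delta$; $(\Rightarrow\exists)^3$: $\mathcal{G}\,|\,\Gamma\Rightarrow\mathfrak{q},\Delta\,|\,\mathfrak{q}\Rightarrow\exists xA\,|\,\mathfrak{q}\Rightarrow[A]^x_t$ / $\mathcal{G}\,|\,\Gamma\Rightarrow\exists xA,\Delta$; $(\exists\Rightarrow)^3$: $\mathcal{G}\,|\,\Gamma,[A]^x_a\Rightarrow\Delta$ / $\mathcal{G}\,|\,\Gamma,\exists xA\Rightarrow\Delta$. Here $\mathfrak{p}$ (type 1) and $\mathfrak{q}$ (type 0) are semipropositional variables not occurring in the conclusion, $t$ is a closed term, and $a$ is a parameter not occurring in the conclusion. Calculus $\mathrm{G}^1\text{\L}\forall$. It works with hypersequents of $\mathrm{G}^1\text{\L}\forall$; its axioms are those of them satisfying the same axiom condition. Its rules (cumulative: each premise contains the conclusion), with the same side conditions on $\mathfrak{p}$ (type 1), $t$, $a$: $(\to\Rightarrow)^1$: $\mathcal{G}\,|\,\Gamma,A\to B\Rightarrow\Delta\,|\,\Gamma,\mathfrak{p}\Rightarrow\Delta\,|\,B\Rightarrow\mathfrak{p},A$ / $\mathcal{G}\,|\,\Gamma,A\to B\Rightarrow\Delta$; $(\Rightarrow\to)^1$: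 $\mathcal{G}\,|\,\Gamma\Rightarrow A\to B,\Delta\,|\,\Gamma\Rightarrow\Delta$ and $\mathcal{G}\,|\,\Gamma\Rightarrow A\to B,\Delta\,|\,\Gamma,A\Rightarrow B,\Delta$ / $\mathcal{G}\,|\,\Gamma\Rightarrow A\to B,\Delta$; $(\forall\Rightarrow)^1$: $\mathcal{G}\,|\,\Gamma,\forall xA\Rightarrow\Delta\,|\,\Gamma,[A]^x_t\Rightarrow\Delta$ / $\mathcal{G}\,|\,\Gamma,\forall xA\Rightarrow\Delta$; $(\Rightarrow\forall)^1$: $\mathcal{G}\,|\,\Gamma\Rightarrow\forall xA,\Delta\,|\,\Gamma\Rightarrow[A]^x_a,\Delta$ / $\mathcal{G}\,|\,\Gamma\Rightarrow\forall xA,\Delta$; $(\Rightarrow\exists)^1$: $\mathcal{G}\,|\,\Gamma\Rightarrow\exists xA,\Delta\,|\,\Gamma\Rightarrow[A]^x_t,\Delta$ / $\mathcal{G}\,|\,\Gamma\Rightarrow\exists xA,\Delta$; $(\exists\Rightarrow)^1$: $\mathcal{G}\,|\,\Gamma,\exists xA\Rightarrow\Delta\,|\,\Gamma,[A]^x_a\Rightarrow\Delta$ / $\mathcal{G}\,|\,\Gamma,\exists xA\Rightarrow\Delta$. Proofs in either calculus are finite trees of hypersequents built by the rules with all leaves axioms. -}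

module Defs where

open import Data.Bool.Base using (if_then_else_)
open import Data.List.Base using (List; []; _∷_; _++_; [_]; concatMap)
open import Data.List.Membership.Propositional using (_∉_)
import Data.List.Relation.Binary.Permutation.Propositional as Multiset
import Data.List.Relation.Binary.Permutation.Setoid as SetoidPermutation
open import Data.List.Relation.Unary.All using (All; []; _∷_)
open import Data.List.Relation.Unary.Any using (Any)
open import Data.Nat.Base as ℕ using (ℕ; _⊔_)
import Data.Nat.Properties as ℕ
open import Data.Product.Base using (Σ; ∃; _×_; _,_; proj₁; proj₂)
open import Data.Product.Relation.Binary.Pointwise.NonDependent using (×-setoid)
open import Data.Rational.Base as ℚ using (ℚ; 0ℚ; 1ℚ; ½)
import Data.Rational.Properties as ℚ
open import Data.Rational.Solver using (module +-*-Solver)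
open import Data.Vec.Base using (Vec; []; _∷_)
open import Level using (0ℓ)
open import Relation.Binary.Bundles using (Setoid)
open import Relation.Binary.PropositionalEquality
  using (_≡_; refl; sym; trans; cong; subst)
open import Relation.Nullary using (¬_)
open import Relation.Nullary.Decidable.Core using (does)

-- Real numbers as Cauchy sequences of rationals.  Two sequences denote
-- the same real when each is ≤ the other.

IsCauchy : (ℕ → ℚ) → Set
IsCauchy s = ∀ ε → 0ℚ ℚ.< ε →
  ∃ λ N → ∀ m n → N ℕ.≤ m → N ℕ.≤ n → ℚ.∣ s m ℚ.- s n ∣ ℚ.< ε

record ℝ : Set where
  constructor _,ᶜ_
  field
    seq      : ℕ → ℚ
    isCauchy : IsCauchy seq

open ℝ public

infix  4 _≤ᴿ_
infixl 6 _+ᴿ_ _-ᴿ_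
infix  8 -ᴿ_

_≤ᴿ_ : ℝ → ℝ → Set
x ≤ᴿ y = ∀ ε → 0ℚ ℚ.< ε →
  ∃ λ N → ∀ n → N ℕ.≤ n → seq x n ℚ.≤ seq y n ℚ.+ ε

fromℚ : ℚ → ℝ
fromℚ q = (λ _ → q) ,ᶜ λ ε 0<ε → 0 , λ _ _ _ _ →
  subst (ℚ._< ε) (sym (cong ℚ.∣_∣ (ℚ.+-inverseʳ q))) 0<ε

0ᴿ 1ᴿ : ℝ
0ᴿ = fromℚ 0ℚ
1ᴿ = fromℚ 1ℚ

private
  half-positive : ∀ {ε} → 0ℚ ℚ.< ε → 0ℚ ℚ.< ½ ℚ.* ε
  half-positive {ε} 0<ε = subst (ℚ._< ½ ℚ.* ε) (ℚ.*-zeroʳ ½)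
    (ℚ.*-monoʳ-<-pos ½ 0<ε)

  halves : ∀ ε → ½ ℚ.* ε ℚ.+ ½ ℚ.* ε ≡ ε
  halves ε = trans (sym (ℚ.*-distribʳ-+ ε ½ ½)) (ℚ.*-identityˡ ε)

_+ᴿ_ : ℝ → ℝ → ℝ
(s ,ᶜ cs) +ᴿ (t ,ᶜ ct) = (λ n → s n ℚ.+ t n) ,ᶜ cauchy
  where
  interchange : ∀ a b c d →
    (a ℚ.+ b) ℚ.- (c ℚ.+ d) ≡ (a ℚ.- c) ℚ.+ (b ℚ.- d)
  interchange = solve 4
    (λ a b c d → (a :+ b) :- (c :+ d) := (a :- c) :+ (b :- d)) refl
    where open +-*-Solver

  cauchy : IsCauchy (λ n → s n ℚ.+ t n)
  cauchy ε 0<ε with cs (½ ℚ.* ε) (half-positive 0<ε)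
                  | ct (½ ℚ.* ε) (half-positive 0<ε)
  ... | N , close | N′ , close′ = N ⊔ N′ , λ m n m≥ n≥ → begin-strict
    ℚ.∣ (s m ℚ.+ t m) ℚ.- (s n ℚ.+ t n) ∣
      ≡⟨ cong ℚ.∣_∣ (interchange (s m) (t m) (s n) (t n)) ⟩
    ℚ.∣ (s m ℚ.- s n) ℚ.+ (t m ℚ.- t n) ∣
      ≤⟨ ℚ.∣p+q∣≤∣p∣+∣q∣ (s m ℚ.- s n) (t m ℚ.- t n) ⟩
    ℚ.∣ s m ℚ.- s n ∣ ℚ.+ ℚ.∣ t m ℚ.- t n ∣
      <⟨ ℚ.+-mono-< (close m n (ℕ.m⊔n≤o⇒m≤o N N′ m≥) (ℕ.m⊔n≤o⇒m≤o N N′ n≥))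
                    (close′ m n (ℕ.m⊔n≤o⇒n≤o N N′ m≥) (ℕ.m⊔n≤o⇒n≤o N N′ n≥)) ⟩
    ½ ℚ.* ε ℚ.+ ½ ℚ.* ε
      ≡⟨ halves ε ⟩
    ε ∎
    where open ℚ.≤-Reasoning

-ᴿ_ : ℝ → ℝ
-ᴿ (s ,ᶜ cs) = (λ n → ℚ.- s n) ,ᶜ λ ε 0<ε →
  proj₁ (cs ε 0<ε) , λ m n m≥ n≥ →
    subst (ℚ._< ε)
      (trans (sym (ℚ.∣-p∣≡∣p∣ (s m ℚ.- s n)))
             (cong ℚ.∣_∣ (ℚ.neg-distrib-+ (s m) (ℚ.- s n))))
      (proj₂ (cs ε 0<ε) m n m≥ n≥)

_-ᴿ_ : ℝ → ℝ → ℝ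
x -ᴿ y = x +ᴿ (-ᴿ y)

record UnitReal : Set where
  constructor unitReal
  field
    value : ℝ
    0≤    : 0ᴿ ≤ᴿ value
    ≤1    : value ≤ᴿ 1ᴿ

record UnitRational : Set where
  constructor unitRational
  field
    value : ℚ
    0≤    : 0ℚ ℚ.≤ value
    ≤1    : value ℚ.≤ 1ℚ

-- Parameters are nullary function symbols belonging to every signature,
-- so only the remaining function symbols are signature-specific.

record Signature : Set₁ where
  field
    Pred      : Set
    predArity : Pred → ℕ
    Func      : Set
    funcArity : Func → ℕ

module Calculus (𝒮 : Signature) where
  open Signature 𝒮

  Variable Parameter : Set
  Variable  = ℕ
  Parameter = ℕ

  data FunctionSymbol : Set where
    param : Parameter → FunctionSymbol
    func  : Func → FunctionSymbol

  arity : FunctionSymbol → ℕ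
  arity (param _) = 0
  arity (func f)  = funcArity f

  data Term : Set where
    var : Variable → Term
    app : (f : FunctionSymbol) → Vec Term (arity f) → Term

  infixr 6 _⊃_

  data RPLFormula : Set where
    atom  : (P : Pred) → Vec Term (predArity P) → RPLFormula
    const : UnitRational → RPLFormula
    _⊃_   : RPLFormula → RPLFormula → RPLFormula
    all   : Variable → RPLFormula → RPLFormula
    ex    : Variable → RPLFormula → RPLFormula

  data Formula : Set where
    rpl : RPLFormula → Formula
    sp₁ : ℕ → Formula
    sp₀ : ℕ → Formula

  data IsAtom : Formula → Set where
    atom  : ∀ {P ts} → IsAtom (rpl (atom P ts))
    const : ∀ {r} → IsAtom (rpl (const r))
    sp₁   : ∀ {p} → IsAtom (sp₁ p)
    sp₀   : ∀ {q} → IsAtom (sp₀ q)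

  variablesᵗ  : Term → List Variable
  variablesᵗˢ : ∀ {n} → Vec Term n → List Variable
  variablesᵗ (var x)    = [ x ]
  variablesᵗ (app _ ts) = variablesᵗˢ ts
  variablesᵗˢ []       = []
  variablesᵗˢ (t ∷ ts) = variablesᵗ t ++ variablesᵗˢ ts

  Closed : Term → Set
  Closed t = variablesᵗ t ≡ []

  infix 9 _[_≔_]ᵗ _[_≔_]ᵗˢ _[_≔_]

  _[_≔_]ᵗ  : Term → Variable → Term → Term
  _[_≔_]ᵗˢ : ∀ {n} → Vec Term n → Variable → Term → Vec Term n
  var y    [ x ≔ t ]ᵗ = if does (x ℕ.≟ y) then t else var y
  app f ts [ x ≔ t ]ᵗ = app f (ts [ x ≔ t ]ᵗˢ)
  []       [ x ≔ t ]ᵗˢ = []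
  (u ∷ us) [ x ≔ t ]ᵗˢ = u [ x ≔ t ]ᵗ ∷ us [ x ≔ t ]ᵗˢ

  -- Bound variables are not renamed; the calculi only substitute closed
  -- terms, for which capture is impossible.
  _[_≔_] : RPLFormula → Variable → Term → RPLFormula
  atom P ts [ x ≔ t ] = atom P (ts [ x ≔ t ]ᵗˢ)
  const r   [ x ≔ t ] = const r
  (A ⊃ B)   [ x ≔ t ] = A [ x ≔ t ] ⊃ B [ x ≔ t ]
  all y A   [ x ≔ t ] = all y (if does (x ℕ.≟ y) then A else A [ x ≔ t ])
  ex y A    [ x ≔ t ] = ex y (if does (x ℕ.≟ y) then A else A [ x ≔ t ])

  parameter : Parameter → Term
  parameter a = app (param a) []

  parametersᵗ  : Term → List Parameter
  parametersᵗˢ : ∀ {n} → Vec Term n → List Parameter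
  parametersᵗ (var _)            = []
  parametersᵗ (app (param a) _)  = [ a ]
  parametersᵗ (app (func _)  ts) = parametersᵗˢ ts
  parametersᵗˢ []       = []
  parametersᵗˢ (t ∷ ts) = parametersᵗ t ++ parametersᵗˢ ts

  parametersᴿ : RPLFormula → List Parameter
  parametersᴿ (atom _ ts) = parametersᵗˢ ts
  parametersᴿ (const _)   = []
  parametersᴿ (A ⊃ B)     = parametersᴿ A ++ parametersᴿ B
  parametersᴿ (all _ A)   = parametersᴿ A
  parametersᴿ (ex _ A)    = parametersᴿ A

  parametersᶠ : Formula → List Parameter
  parametersᶠ (rpl A) = parametersᴿ A
  parametersᶠ (sp₁ _) = []
  parametersᶠ (sp₀ _) = []

  -- Finite multisets are lists, identified up to permutation.

  Sequent : Set
  Sequent = List Formula × List Formula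

  infix 4 _⇒_
  pattern _⇒_ Γ Δ = Γ , Δ

  Hypersequent : Set
  Hypersequent = List Sequent

  infixl 3 _┃_
  pattern _┃_ 𝒢 S = S ∷ 𝒢

  sequentSetoid : Setoid 0ℓ 0ℓ
  sequentSetoid = ×-setoid multisets multisets
    where multisets = Multiset.↭-setoid {A = Formula}

  open SetoidPermutation sequentSetoid public
    using () renaming (_↭_ to _≈ᴴ_)

  members : Hypersequent → List Formula
  members = concatMap λ (Γ ⇒ Δ) → Γ ++ Δ

  parameters : Hypersequent → List Parameter
  parameters H = concatMap parametersᶠ (members H)

  IsG¹Hypersequent : Hypersequent → Set
  IsG¹Hypersequent H = ∀ q → sp₀ q ∉ members H

  record HsInterpretation : Set₁ where
    field
      Domain    : Set
      inhabited : Domain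
      funᴹ      : (f : FunctionSymbol) → Vec Domain (arity f) → Domain
      predᴹ     : (P : Pred) → Vec Domain (predArity P) → UnitReal
      sp₀ᴹ      : ℕ → Σ ℝ (λ v → 0ᴿ ≤ᴿ v)
      sp₁ᴹ      : ℕ → Σ ℝ (λ v → v ≤ᴿ 1ᴿ)

  module Semantics (M : HsInterpretation)
                   (ν : Variable → HsInterpretation.Domain M) where
    open HsInterpretation M

    ⟦_⟧ᵗ  : Term → Domain
    ⟦_⟧ᵗˢ : ∀ {n} → Vec Term n → Vec Domain n
    ⟦ var x ⟧ᵗ    = ν x
    ⟦ app f ts ⟧ᵗ = funᴹ f ⟦ ts ⟧ᵗˢ
    ⟦ [] ⟧ᵗˢ     = []
    ⟦ t ∷ ts ⟧ᵗˢ = ⟦ t ⟧ᵗ ∷ ⟦ ts ⟧ᵗˢ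

    ⟦_⟧ : ∀ {F} → IsAtom F → ℝ
    ⟦ atom {P} {ts} ⟧ = UnitReal.value (predᴹ P ⟦ ts ⟧ᵗˢ)
    ⟦ const {r} ⟧     = fromℚ (UnitRational.value r)
    ⟦ sp₁ {p} ⟧       = proj₁ (sp₁ᴹ p)
    ⟦ sp₀ {q} ⟧       = proj₁ (sp₀ᴹ q)

    ⟦_⟧ᴸ : ∀ {Γ} → All IsAtom Γ → ℝ
    ⟦ [] ⟧ᴸ     = 0ᴿ
    ⟦ F ∷ Γ ⟧ᴸ = (⟦ F ⟧ -ᴿ 1ᴿ) +ᴿ ⟦ Γ ⟧ᴸ

    data TrueAtomic : Sequent → Set where
      trueAtomic : ∀ {Γ Δ} (Γ-atoms : All IsAtom Γ) (Δ-atoms : All IsAtom Δ) →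
        0ᴿ ≤ᴿ ⟦ Δ-atoms ⟧ᴸ -ᴿ ⟦ Γ-atoms ⟧ᴸ → TrueAtomic (Γ ⇒ Δ)

  -- The double negation gives "there is" its classical meaning.  Without
  -- it, the order on the reals being only classically total, even
  -- P ⇒ Q ┃ Q ⇒ P could not be shown to be an axiom.
  IsAxiom : Hypersequent → Set₁
  IsAxiom H = (M : HsInterpretation) (ν : Variable → HsInterpretation.Domain M) →
    ¬ ¬ Any (Semantics.TrueAtomic M ν) H

  -- The constructor exchange identifies lists that
  -- represent the same hypersequent; it is not an additional rule.

  data ProvableG³ : Hypersequent → Set₁ where

    axiom : ∀ {H} → IsAxiom H → ProvableG³ H

    exchange : ∀ {H H′} → H ≈ᴴ H′ → ProvableG³ H → ProvableG³ H′

    →⇒ : ∀ {𝒢 Γ Δ A B} p →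
      let H = 𝒢 ┃ (rpl (A ⊃ B) ∷ Γ ⇒ Δ) in
      sp₁ p ∉ members H →
      ProvableG³ (𝒢 ┃ (sp₁ p ∷ Γ ⇒ Δ) ┃ (rpl B ∷ [] ⇒ sp₁ p ∷ rpl A ∷ [])) →
      ProvableG³ H

    ⇒→ : ∀ {𝒢 Γ Δ A B} →
      ProvableG³ (𝒢 ┃ (Γ ⇒ Δ)) →
      ProvableG³ (𝒢 ┃ (rpl A ∷ Γ ⇒ rpl B ∷ Δ)) →
      ProvableG³ (𝒢 ┃ (Γ ⇒ rpl (A ⊃ B) ∷ Δ))

    ∀⇒ : ∀ {𝒢 Γ Δ x A} p t →
      let H = 𝒢 ┃ (rpl (all x A) ∷ Γ ⇒ Δ) in
      sp₁ p ∉ members H → Closed t →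
      ProvableG³ (𝒢 ┃ (sp₁ p ∷ Γ ⇒ Δ)
                    ┃ (rpl (all x A) ∷ [] ⇒ sp₁ p ∷ [])
                    ┃ (rpl (A [ x ≔ t ]) ∷ [] ⇒ sp₁ p ∷ [])) →
      ProvableG³ H

    ⇒∀ : ∀ {𝒢 Γ Δ x A} a →
      let H = 𝒢 ┃ (Γ ⇒ rpl (all x A) ∷ Δ) in
      a ∉ parameters H →
      ProvableG³ (𝒢 ┃ (Γ ⇒ rpl (A [ x ≔ parameter a ]) ∷ Δ)) →
      ProvableG³ H

    ⇒∃ : ∀ {𝒢 Γ Δ x A} q t →
      let H = 𝒢 ┃ (Γ ⇒ rpl (ex x A) ∷ Δ) in
      sp₀ q ∉ members H → Closed t →
      ProvableG³ (𝒢 ┃ (Γ ⇒ sp₀ q ∷ Δ)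
                    ┃ (sp₀ q ∷ [] ⇒ rpl (ex x A) ∷ [])
                    ┃ (sp₀ q ∷ [] ⇒ rpl (A [ x ≔ t ]) ∷ [])) →
      ProvableG³ H

    ∃⇒ : ∀ {𝒢 Γ Δ x A} a →
      let H = 𝒢 ┃ (rpl (ex x A) ∷ Γ ⇒ Δ) in
      a ∉ parameters H →
      ProvableG³ (𝒢 ┃ (rpl (A [ x ≔ parameter a ]) ∷ Γ ⇒ Δ)) →
      ProvableG³ H

  -- Excluding type 0 variables from axioms excludes them from every
  -- provable hypersequent, as each premise contains the conclusion.
  data ProvableG¹ : Hypersequent → Set₁ where

    axiom : ∀ {H} → IsG¹Hypersequent H → IsAxiom H → ProvableG¹ H

    exchange : ∀ {H H′} → H ≈ᴴ H′ → ProvableG¹ H → ProvableG¹ H′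

    →⇒ : ∀ {𝒢 Γ Δ A B} p →
      let H = 𝒢 ┃ (rpl (A ⊃ B) ∷ Γ ⇒ Δ) in
      sp₁ p ∉ members H →
      ProvableG¹ (H ┃ (sp₁ p ∷ Γ ⇒ Δ) ┃ (rpl B ∷ [] ⇒ sp₁ p ∷ rpl A ∷ [])) →
      ProvableG¹ H

    ⇒→ : ∀ {𝒢 Γ Δ A B} →
      let H = 𝒢 ┃ (Γ ⇒ rpl (A ⊃ B) ∷ Δ) in
      ProvableG¹ (H ┃ (Γ ⇒ Δ)) →
      ProvableG¹ (H ┃ (rpl A ∷ Γ ⇒ rpl B ∷ Δ)) →
      ProvableG¹ H

    ∀⇒ : ∀ {𝒢 Γ Δ x A} t →
      let H = 𝒢 ┃ (rpl (all x A) ∷ Γ ⇒ Δ) in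
      Closed t →
      ProvableG¹ (H ┃ (rpl (A [ x ≔ t ]) ∷ Γ ⇒ Δ)) →
      ProvableG¹ H

    ⇒∀ : ∀ {𝒢 Γ Δ x A} a →
      let H = 𝒢 ┃ (Γ ⇒ rpl (all x A) ∷ Δ) in
      a ∉ parameters H →
      ProvableG¹ (H ┃ (Γ ⇒ rpl (A [ x ≔ parameter a ]) ∷ Δ)) →
      ProvableG¹ H

    ⇒∃ : ∀ {𝒢 Γ Δ x A} t →
      let H = 𝒢 ┃ (Γ ⇒ rpl (ex x A) ∷ Δ) in
      Closed t →
      ProvableG¹ (H ┃ (Γ ⇒ rpl (A [ x ≔ t ]) ∷ Δ)) →
      ProvableG¹ H

    ∃⇒ : ∀ {𝒢 Γ Δ x A} a →
      let H = 𝒢 ┃ (rpl (ex x A) ∷ Γ ⇒ Δ) in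
      a ∉ parameters H →
      ProvableG¹ (H ┃ (rpl (A [ x ≔ parameter a ]) ∷ Γ ⇒ Δ)) →
      ProvableG¹ H

{-# OPTIONS --safe #-}
module Submission where

-- Rules are cumulative in G¹ and contraction-free in G³, so the point is that
-- external contraction is admissible in G³.  The key lemma splits a sequent at
-- an atom s without increasing the height of a derivation: 𝒢 | Γ,Γ′ ⇒ Δ,Δ′
-- yields 𝒢 | s,Γ ⇒ Δ | Γ′ ⇒ s,Δ′, since the balances of the two parts add up to
-- that of the whole.  It makes up for the missing inversion of (∀⇒) and (⇒∃):
-- Γ,∀xA ⇒ Δ splits at p into Γ,p ⇒ Δ | ∀xA ⇒ p.  The other rules are invertible
-- with the same height, and contraction follows by induction on the height.
-- Then (∀⇒)¹ is simulated by splitting both Γ,∀xA ⇒ Δ and Γ,A(t) ⇒ Δ at p,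
-- contracting the two copies of Γ,p ⇒ Δ and applying (∀⇒)³.  Dually for (⇒∃)¹;
-- the remaining rules of G¹ need only inversion and contraction.

open import Defs

open import Algebra.Bundles using (CommutativeMonoid)
import Algebra.Construct.DirectProduct as DirectProduct
import Algebra.Properties.CommutativeSemigroup as CommutativeSemigroup
open import Data.Bool.Base using (true; false; if_then_else_)
open import Data.List.Base using (List; []; _∷_; _++_; [_]; map)
open import Data.List.Extrema.Nat using (max; xs≤max)
import Data.List.Properties as List
open import Data.List.Membership.Propositional using (_∈_; _∉_)
open import Data.List.Membership.Propositional.Properties
  using (∈-map⁺; ∈-concatMap⁺; ∈-++⁺ˡ; ∈-++⁺ʳ)
import Data.List.Relation.Binary.Permutation.Propositional as Multiset
import Data.List.Relation.Binary.Permutation.Propositional.Properties as Multisetₚ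
import Data.List.Relation.Binary.Permutation.Setoid as SetoidPermutation
import Data.List.Relation.Binary.Permutation.Setoid.Properties as SetoidPermutationₚ
open import Data.List.Relation.Binary.Pointwise using (_∷_)
open import Data.List.Relation.Unary.All as All using (All; []; _∷_)
import Data.List.Relation.Unary.All.Properties as All
open import Data.List.Relation.Unary.Any as Any using (Any; here; there)
import Data.List.Relation.Unary.Any.Properties as Any
open import Data.Nat.Base as ℕ using (ℕ; suc; _⊔_; _≤_; s≤s)
import Data.Nat.Properties as ℕ
open import Data.Product.Base using (∃; ∃₂; _×_; _,_; proj₁; proj₂)
open import Data.Rational.Base as ℚ using (ℚ; 0ℚ; 1ℚ; ½)
import Data.Rational.Properties as ℚ
open import Data.Rational.Solver using (module +-*-Solver)
open import Data.Sum.Base using (_⊎_; inj₁; inj₂)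
open import Data.Vec.Base using (Vec; []; _∷_)
open import Function.Base using (id; _∘_; case_of_)
open import Relation.Binary.Bundles using (Setoid)
open import Relation.Binary.PropositionalEquality
  using (_≡_; _≢_; refl; sym; trans; cong; cong₂; subst; setoid; module ≡-Reasoning)
open import Relation.Nullary using (¬_; yes; no; contradiction)
open import Relation.Nullary.Decidable using (dec-true; dec-false)
open import Relation.Nullary.Decidable.Core using (does)

-- Order and arithmetic of Cauchy reals

0≤-cong : ∀ {x y} → (∀ n → seq x n ≡ seq y n) → 0ᴿ ≤ᴿ x → 0ᴿ ≤ᴿ y
0≤-cong x≐y 0≤x ε 0<ε with 0≤x ε 0<ε
... | N , bound = N , λ n N≤n →
  subst (λ q → 0ℚ ℚ.≤ q ℚ.+ ε) (x≐y n) (bound n N≤n)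

½*-positive : ∀ {ε} → 0ℚ ℚ.< ε → 0ℚ ℚ.< ½ ℚ.* ε
½*-positive {ε} 0<ε = subst (ℚ._< ½ ℚ.* ε) (ℚ.*-zeroʳ ½) (ℚ.*-monoʳ-<-pos ½ 0<ε)

p≤∣p∣ : ∀ p → p ℚ.≤ ℚ.∣ p ∣
p≤∣p∣ p with ℚ.≤-total 0ℚ p
... | inj₁ 0≤p = ℚ.≤-reflexive (sym (ℚ.0≤p⇒∣p∣≡p 0≤p))
... | inj₂ p≤0 = ℚ.≤-trans p≤0 (ℚ.0≤∣p∣ p)

-- The form of totality that `split-sound` needs. From `N` on, the sequence stays within half of `ε`
-- of `seq x N`, so comparing that single rational with half of `ε`, which is decidable, settles the
-- whole tail.
0≰⇒≤0 : ∀ x → ¬ 0ᴿ ≤ᴿ x → x ≤ᴿ 0ᴿ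
0≰⇒≤0 x 0≰x ε 0<ε with isCauchy x (½ ℚ.* ε) (½*-positive 0<ε)
... | N , close with seq x N ℚ.≤? ½ ℚ.* ε
...   | yes xN≤½ε = N , λ n N≤n → begin
        seq x n
          ≡⟨ solve 2 (λ a b → a := (a :- b) :+ b) refl (seq x n) (seq x N) ⟩
        (seq x n ℚ.- seq x N) ℚ.+ seq x N
          ≤⟨ ℚ.+-mono-≤ (ℚ.≤-trans (p≤∣p∣ _) (ℚ.<⇒≤ (close n N N≤n ℕ.≤-refl))) xN≤½ε ⟩
        ½ ℚ.* ε ℚ.+ ½ ℚ.* ε
          ≡⟨ solve 1 (λ e → con ½ :* e :+ con ½ :* e := con 0ℚ :+ e) refl ε ⟩
        0ℚ ℚ.+ ε ∎
  where
  open ℚ.≤-Reasoning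
  open +-*-Solver
-- Here every later term is positive, so the same `N` serves for all `ε′`, against the assumption.
...   | no xN≰½ε = contradiction (λ ε′ 0<ε′ → N , λ n N≤n → ℚ.<⇒≤ (begin-strict
        0ℚ
          ≡⟨ solve 2 (λ a b → con 0ℚ := (a :- b) :+ (b :- a)) refl (seq x N) (seq x n) ⟩
        (seq x N ℚ.- seq x n) ℚ.+ (seq x n ℚ.- seq x N)
          <⟨ ℚ.+-monoˡ-< (seq x n ℚ.- seq x N) (ℚ.≤-<-trans (p≤∣p∣ _)
               (ℚ.<-trans (close N n ℕ.≤-refl N≤n) (ℚ.≰⇒> xN≰½ε))) ⟩
        seq x N ℚ.+ (seq x n ℚ.- seq x N)
          ≡⟨ solve 2 (λ a b → a :+ (b :- a) := b :+ con 0ℚ) refl (seq x N) (seq x n) ⟩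
        seq x n ℚ.+ 0ℚ
          <⟨ ℚ.+-monoʳ-< (seq x n) 0<ε′ ⟩
        seq x n ℚ.+ ε′ ∎)) 0≰x
  where
  open ℚ.≤-Reasoning
  open +-*-Solver

0≤+∧≤0⇒0≤ : ∀ x y → 0ᴿ ≤ᴿ x +ᴿ y → x ≤ᴿ 0ᴿ → 0ᴿ ≤ᴿ y
0≤+∧≤0⇒0≤ x y 0≤x+y x≤0 ε 0<ε
  with 0≤x+y (½ ℚ.* ε) (½*-positive 0<ε) | x≤0 (½ ℚ.* ε) (½*-positive 0<ε)
... | N , lower | N′ , upper = N ⊔ N′ , λ n n≥ → begin
  0ℚ
    ≤⟨ lower n (ℕ.m⊔n≤o⇒m≤o N N′ n≥) ⟩
  (seq x n ℚ.+ seq y n) ℚ.+ ½ ℚ.* ε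
    ≤⟨ ℚ.+-monoˡ-≤ (½ ℚ.* ε) (ℚ.+-monoˡ-≤ (seq y n)
         (upper n (ℕ.m⊔n≤o⇒n≤o N N′ n≥))) ⟩
  ((0ℚ ℚ.+ ½ ℚ.* ε) ℚ.+ seq y n) ℚ.+ ½ ℚ.* ε
    ≡⟨ solve 2 (λ b e → ((con 0ℚ :+ con ½ :* e) :+ b) :+ con ½ :* e := b :+ e)
         refl (seq y n) ε ⟩
  seq y n ℚ.+ ε ∎
  where
  open ℚ.≤-Reasoning
  open +-*-Solver

+-swap : ∀ a b c → a ℚ.+ (b ℚ.+ c) ≡ b ℚ.+ (a ℚ.+ c)
+-swap = solve 3 (λ a b c → a :+ (b :+ c) := b :+ (a :+ c)) refl
  where open +-*-Solver

+-interchange : ∀ a b c d → (a ℚ.+ b) ℚ.+ (c ℚ.+ d) ≡ (a ℚ.+ c) ℚ.+ (d ℚ.+ b)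
+-interchange = solve 4 (λ a b c d → (a :+ b) :+ (c :+ d) := (a :+ c) :+ (d :+ b)) refl
  where open +-*-Solver

+-minus-interchange : ∀ a b c d → (a ℚ.+ b) ℚ.- (c ℚ.+ d) ≡ (a ℚ.- c) ℚ.+ (b ℚ.- d)
+-minus-interchange = solve 4 (λ a b c d → (a :+ b) :- (c :+ d) := (a :- c) :+ (b :- d)) refl
  where open +-*-Solver

0-a+a-0 : ∀ a → (0ℚ ℚ.- a) ℚ.+ (a ℚ.- 0ℚ) ≡ 0ℚ
0-a+a-0 = solve 1 (λ a → (con 0ℚ :- a) :+ (a :- con 0ℚ) := con 0ℚ) refl
  where open +-*-Solver

-- Decomposing multisets and sequents

module _ {a ℓ} (A : Setoid a ℓ) where
  open Setoid A using (_≈_)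
  open SetoidPermutation A using (_↭_; ↭-transˡ-≋; ↭-trans; ↭-sym; ↭-refl; prep)

  -- `↭-split` locates `y` in `x ∷ xs`. An empty prefix means that `y` matches the head; otherwise
  -- the prefix begins with `x`, and what remains besides `x` and `y` is the common part.
  ∷↭∷⁻ : ∀ {x y xs ys} → x ∷ xs ↭ y ∷ ys →
    (x ≈ y × xs ↭ ys) ⊎ ∃ λ zs → xs ↭ y ∷ zs × ys ↭ x ∷ zs
  ∷↭∷⁻ {y = y} {ys = ys} p with SetoidPermutationₚ.↭-split A y [] ys p
  ... | [] , _ , x≈y ∷ xs≋qs , qs↭ys =
    inj₁ (x≈y , ↭-transˡ-≋ xs≋qs qs↭ys)
  ... | z ∷ ps , qs , x≈z ∷ xs≋ , ↭ys = inj₂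
    ( ps ++ qs
    , ↭-transˡ-≋ xs≋ (SetoidPermutationₚ.↭-shift A ps qs)
    , ↭-trans (↭-sym ↭ys) (prep (Setoid.sym A x≈z) ↭-refl))

module Translation (𝒮 : Signature) where
  open Calculus 𝒮
  open Multiset using (_↭_; ↭-refl; ↭-sym; ↭-trans; prep)
  open SetoidPermutation sequentSetoid using ()
    renaming (↭-refl to ≈ᴴ-refl; ↭-sym to ≈ᴴ-sym; ↭-trans to ≈ᴴ-trans; prep to ≈ᴴ-prep
             ; ↭-swap to ≈ᴴ-swap)
  module H = SetoidPermutationₚ sequentSetoid

  -- Sequents as a product of two multiset monoids, with the `single l F` as generators: left and
  -- right rules can then be treated by one argument in the side `l`.
  sequentMonoid : CommutativeMonoid _ _
  sequentMonoid = DirectProduct.commutativeMonoid multisets multisets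
    where multisets = Multisetₚ.++-commutativeMonoid {A = Formula}

  open CommutativeMonoid sequentMonoid
    using (commutativeSemigroup)
    renaming ( _∙_ to _⊕_; _≈_ to _≈ˢ_; refl to ≈ˢ-refl; sym to ≈ˢ-sym
             ; trans to ≈ˢ-trans; ∙-congˡ to ⊕-congˡ; ∙-congʳ to ⊕-congʳ
             ; assoc to ⊕-assoc; comm to ⊕-comm )
  open CommutativeSemigroup commutativeSemigroup using (x∙yz≈y∙xz)

  data Side : Set where
    left right : Side

  opposite : Side → Side
  opposite left  = right
  opposite right = left

  single : Side → Formula → Sequent
  single left  F = [ F ] ⇒ []
  single right F = [] ⇒ [ F ]

  ∷↭∷-multiset : ∀ {F G : Formula} {Γ Δ} → F ∷ Γ ↭ G ∷ Δ →
    (F ≡ G × Γ ↭ Δ) ⊎ ∃ λ Θ → Γ ↭ G ∷ Θ × Δ ↭ F ∷ Θ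
  ∷↭∷-multiset p with ∷↭∷⁻ (setoid Formula) (Multiset.↭⇒↭ₛ p)
  ... | inj₁ (F≡G , q)   = inj₁ (F≡G , Multiset.↭ₛ⇒↭ q)
  ... | inj₂ (Θ , q , r) = inj₂ (Θ , Multiset.↭ₛ⇒↭ q , Multiset.↭ₛ⇒↭ r)

  single⊕-single⊕ : ∀ k l {F G S T} → single k F ⊕ S ≈ˢ single l G ⊕ T →
    (k ≡ l × F ≡ G × S ≈ˢ T) ⊎ ∃ λ U → S ≈ˢ single l G ⊕ U × T ≈ˢ single k F ⊕ U
  single⊕-single⊕ left left (p , q) with ∷↭∷-multiset p
  ... | inj₁ (F≡G , p′)     = inj₁ (refl , F≡G , p′ , q)
  ... | inj₂ (Θ , p′ , p″)  = inj₂ ((Θ , _) , (p′ , q) , (p″ , ↭-refl))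
  single⊕-single⊕ right right (p , q) with ∷↭∷-multiset q
  ... | inj₁ (F≡G , q′)     = inj₁ (refl , F≡G , p , q′)
  ... | inj₂ (Θ , q′ , q″)  = inj₂ ((_ , Θ) , (p , q′) , (↭-refl , q″))
  -- On opposite sides the two occurrences are always distinct. The side of `U` on which `F` stood
  -- comes from `S`, the other from `T`.
  single⊕-single⊕ left right {S = S} {T} (p , q) =
    inj₂ ((proj₁ S , proj₂ T) , (↭-refl , q) , (↭-sym p , ↭-refl))
  single⊕-single⊕ right left {S = S} {T} (p , q) =
    inj₂ ((proj₁ T , proj₂ S) , (p , ↭-refl) , (↭-refl , ↭-sym q))

  ∷↭++⁻ : ∀ {F : Formula} {Γ} Δ {Θ} → F ∷ Γ ↭ Δ ++ Θ →
    (∃ λ Δ′ → Δ ↭ F ∷ Δ′ × Γ ↭ Δ′ ++ Θ) ⊎ (∃ λ Θ′ → Θ ↭ F ∷ Θ′ × Γ ↭ Δ ++ Θ′)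
  ∷↭++⁻ [] {[]} p = contradiction p Multisetₚ.¬x∷xs↭[]
  ∷↭++⁻ [] {G ∷ Θ} p = inj₂ (_ , ↭-sym p , ↭-refl)
  ∷↭++⁻ (G ∷ Δ) p with ∷↭∷-multiset p
  ... | inj₁ (refl , q) = inj₁ (Δ , ↭-refl , q)
  ... | inj₂ (Ψ , q , r) with ∷↭++⁻ Δ (↭-sym r)
  ...   | inj₁ (Δ′ , s , t) = inj₁
          (G ∷ Δ′ , ↭-trans (prep G s) (Multiset.swap _ _ ↭-refl) , ↭-trans q (prep G t))
  ...   | inj₂ (Θ′ , s , t) = inj₂ (Θ′ , s , ↭-trans q (prep G t))

  single⊕-⊕ : ∀ k {F S} T₁ {T₂} → single k F ⊕ S ≈ˢ T₁ ⊕ T₂ →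
    (∃ λ U → T₁ ≈ˢ single k F ⊕ U × S ≈ˢ U ⊕ T₂) ⊎
    (∃ λ U → T₂ ≈ˢ single k F ⊕ U × S ≈ˢ T₁ ⊕ U)
  single⊕-⊕ left T₁ (p , q) with ∷↭++⁻ (proj₁ T₁) p
  ... | inj₁ (Θ , r , s) = inj₁ (_ , (r , ↭-refl) , (s , q))
  ... | inj₂ (Θ , r , s) = inj₂ (_ , (r , ↭-refl) , (s , q))
  single⊕-⊕ right T₁ (p , q) with ∷↭++⁻ (proj₂ T₁) q
  ... | inj₁ (Θ , r , s) = inj₁ (_ , (↭-refl , r) , (p , s))
  ... | inj₂ (Θ , r , s) = inj₂ (_ , (↭-refl , r) , (p , s))

  -- A uniform presentation of the rules, with bounded height

  Premise : Set
  Premise = Sequent × Hypersequent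

  -- `L` takes the place of the principal formula beside the context `S`, while the sequents of `E`
  -- do not involve the context. The order is chosen so that the results are definitionally the
  -- premises in `ProvableG³`.
  plug : Premise → Sequent → Hypersequent → Hypersequent
  plug (L , E) S 𝒢 = E ++ (L ⊕ S) ∷ 𝒢

  -- Rule l A Ps: the rule with principal formula A on side l of a sequent has
  -- the premises Ps a, where a is the index of the eigenvariable.
  data Rule : Side → RPLFormula → (ℕ → List Premise) → Set where
    →⇒ : ∀ {A B} → Rule left (A ⊃ B) λ p →
      [ single left (sp₁ p) , [ ([ rpl B ] ⇒ sp₁ p ∷ [ rpl A ]) ] ]
    ⇒→ : ∀ {A B} → Rule right (A ⊃ B) λ _ →
      (([] ⇒ []) , []) ∷ [ ([ rpl A ] ⇒ [ rpl B ]) , [] ]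
    ∀⇒ : ∀ {x A} t → Closed t → Rule left (all x A) λ p →
      [ single left (sp₁ p)
      , ([ rpl (A [ x ≔ t ]) ] ⇒ [ sp₁ p ]) ∷ [ ([ rpl (all x A) ] ⇒ [ sp₁ p ]) ] ]
    ⇒∀ : ∀ {x A} → Rule right (all x A) λ a →
      [ single right (rpl (A [ x ≔ parameter a ])) , [] ]
    ⇒∃ : ∀ {x A} t → Closed t → Rule right (ex x A) λ q →
      [ single right (sp₀ q)
      , ([ sp₀ q ] ⇒ [ rpl (A [ x ≔ t ]) ]) ∷ [ ([ sp₀ q ] ⇒ [ rpl (ex x A) ]) ] ]
    ∃⇒ : ∀ {x A} → Rule left (ex x A) λ a →
      [ single left (rpl (A [ x ≔ parameter a ])) , [] ]

  -- The rules whose premises are determined by the side and the principal formula. In `∀⇒` and `⇒∃`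
  -- they depend on the chosen term as well.
  data Invertible : ∀ {l A Ps} → Rule l A Ps → Set where
    →⇒ : ∀ {A B} → Invertible (→⇒ {A} {B})
    ⇒→ : ∀ {A B} → Invertible (⇒→ {A} {B})
    ⇒∀ : ∀ {x A} → Invertible (⇒∀ {x} {A})
    ∃⇒ : ∀ {x A} → Invertible (∃⇒ {x} {A})

  invertible-unique : ∀ {l A Ps Qs} {R : Rule l A Ps} → Invertible R → Rule l A Qs → Ps ≡ Qs
  invertible-unique →⇒ →⇒ = refl
  invertible-unique ⇒→ ⇒→ = refl
  invertible-unique ⇒∀ ⇒∀ = refl
  invertible-unique ∃⇒ ∃⇒ = refl

  principal-compound : ∀ {l A Ps} → Rule l A Ps → ¬ IsAtom (rpl A)
  principal-compound →⇒ ()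
  principal-compound ⇒→ ()
  principal-compound (∀⇒ _ _) ()
  principal-compound ⇒∀ ()
  principal-compound (⇒∃ _ _) ()
  principal-compound ∃⇒ ()

  -- The premises are required for every eigenvariable, fresh or not, and
  -- exchange is part of each rule, so that n bounds the height up to exchange.
  data Derivable : ℕ → Hypersequent → Set₁ where
    axiom : ∀ {n H} → IsAxiom H → Derivable n H
    infer : ∀ {n H l A Ps S 𝒢} → Rule l A Ps → H ≈ᴴ (single l (rpl A) ⊕ S) ∷ 𝒢 →
      (∀ a {P} → P ∈ Ps a → Derivable n (plug P S 𝒢)) → Derivable (suc n) H

  -- Semantic soundness of splitting

  module _ (M : HsInterpretation) (ν : Variable → HsInterpretation.Domain M) where
    open HsInterpretation M
    open Semantics M ν

    -- Being total, it makes sums independent of the proofs that their members are atoms; those are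
    -- kept apart in `Atomic`.
    value : Formula → ℝ
    value (rpl (atom P ts)) = UnitReal.value (predᴹ P ⟦ ts ⟧ᵗˢ)
    value (rpl (const r))   = fromℚ (UnitRational.value r)
    -- A dummy for compound formulas, which never occur in a sequent that is `Atomic`.
    value (rpl _)           = 0ᴿ
    value (sp₁ p)           = proj₁ (sp₁ᴹ p)
    value (sp₀ q)           = proj₁ (sp₀ᴹ q)

    weight : List Formula → ℝ
    weight []      = 0ᴿ
    weight (F ∷ Γ) = (value F -ᴿ 1ᴿ) +ᴿ weight Γ

    ⟦⟧≡value : ∀ {F} (i : IsAtom F) → ⟦ i ⟧ ≡ value F
    ⟦⟧≡value atom  = refl
    ⟦⟧≡value const = refl
    ⟦⟧≡value sp₁   = refl
    ⟦⟧≡value sp₀   = refl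

    ⟦⟧ᴸ≐weight : ∀ {Γ} (is : All IsAtom Γ) n → seq ⟦ is ⟧ᴸ n ≡ seq (weight Γ) n
    ⟦⟧ᴸ≐weight []       n = refl
    ⟦⟧ᴸ≐weight {F ∷ Γ} (i ∷ is) n =
      cong₂ (λ x y → (x ℚ.- 1ℚ) ℚ.+ y) (cong (λ x → seq x n) (⟦⟧≡value i)) (⟦⟧ᴸ≐weight is n)

    excess : Sequent → ℝ
    excess (Γ ⇒ Δ) = weight Δ -ᴿ weight Γ

    Atomic : Sequent → Set
    Atomic (Γ ⇒ Δ) = All IsAtom Γ × All IsAtom Δ

    true⁻ : ∀ {S} → TrueAtomic S → Atomic S × 0ᴿ ≤ᴿ excess S
    true⁻ {Γ , Δ} (trueAtomic is js 0≤) = (is , js) ,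
      0≤-cong {⟦ js ⟧ᴸ -ᴿ ⟦ is ⟧ᴸ} {excess (Γ , Δ)}
        (λ n → cong₂ ℚ._-_ (⟦⟧ᴸ≐weight js n) (⟦⟧ᴸ≐weight is n)) 0≤

    true⁺ : ∀ {S} → Atomic S → 0ᴿ ≤ᴿ excess S → TrueAtomic S
    true⁺ {Γ , Δ} (is , js) 0≤ = trueAtomic is js
      (0≤-cong {excess (Γ , Δ)} {⟦ js ⟧ᴸ -ᴿ ⟦ is ⟧ᴸ}
        (λ n → cong₂ ℚ._-_ (sym (⟦⟧ᴸ≐weight js n)) (sym (⟦⟧ᴸ≐weight is n))) 0≤)

    weight-↭ : ∀ {Γ Δ} → Γ ↭ Δ → ∀ n → seq (weight Γ) n ≡ seq (weight Δ) n
    weight-↭ Multiset.refl n = refl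
    weight-↭ (prep F p) n = cong (seq (value F -ᴿ 1ᴿ) n ℚ.+_) (weight-↭ p n)
    weight-↭ (Multiset.swap {ys = Δ} F G p) n = trans
      (cong (λ q → seq (value F -ᴿ 1ᴿ) n ℚ.+ (seq (value G -ᴿ 1ᴿ) n ℚ.+ q)) (weight-↭ p n))
      (+-swap (seq (value F -ᴿ 1ᴿ) n) (seq (value G -ᴿ 1ᴿ) n) (seq (weight Δ) n))
    weight-↭ (Multiset.trans p q) n = trans (weight-↭ p n) (weight-↭ q n)

    excess-≈ : ∀ {S T} → S ≈ˢ T → ∀ n → seq (excess S) n ≡ seq (excess T) n
    excess-≈ (p , q) n = cong₂ ℚ._-_ (weight-↭ q n) (weight-↭ p n)

    Atomic-≈ : ∀ {S T} → S ≈ˢ T → Atomic S → Atomic T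
    Atomic-≈ (p , q) (is , js) = Multisetₚ.All-resp-↭ p is , Multisetₚ.All-resp-↭ q js

    TrueAtomic-≈ : ∀ {S T} → S ≈ˢ T → TrueAtomic S → TrueAtomic T
    TrueAtomic-≈ {S} {T} S≈T t with true⁻ t
    ... | at , 0≤ = true⁺ (Atomic-≈ S≈T at) (0≤-cong {excess S} {excess T} (excess-≈ {S} {T} S≈T) 0≤)

    weight-++ : ∀ Γ {Δ} n → seq (weight (Γ ++ Δ)) n ≡ seq (weight Γ) n ℚ.+ seq (weight Δ) n
    weight-++ [] n = sym (ℚ.+-identityˡ _)
    weight-++ (F ∷ Γ) {Δ} n = trans
      (cong (seq (value F -ᴿ 1ᴿ) n ℚ.+_) (weight-++ Γ {Δ} n))
      (sym (ℚ.+-assoc (seq (value F -ᴿ 1ᴿ) n) (seq (weight Γ) n) (seq (weight Δ) n)))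

    excess-⊕ : ∀ S {T} n → seq (excess (S ⊕ T)) n ≡ seq (excess S) n ℚ.+ seq (excess T) n
    excess-⊕ (Γ , Δ) {Γ′ , Δ′} n = trans
      (cong₂ ℚ._-_ (weight-++ Δ {Δ′} n) (weight-++ Γ {Γ′} n))
      (+-minus-interchange (seq (weight Δ) n) (seq (weight Δ′) n) (seq (weight Γ) n) (seq (weight Γ′) n))

    -- An atom counts with opposite signs on the two sides, so adding it once on each leaves the
    -- total balance unchanged.
    excess-opposite : ∀ l F n →
      seq (excess (single l F)) n ℚ.+ seq (excess (single (opposite l) F)) n ≡ 0ℚ
    excess-opposite left  F n = 0-a+a-0 (seq (weight [ F ]) n)
    excess-opposite right F n = trans
      (ℚ.+-comm (seq (weight [ F ]) n ℚ.- 0ℚ) (0ℚ ℚ.- seq (weight [ F ]) n))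
      (0-a+a-0 (seq (weight [ F ]) n))

    Atomic-⊕⁻ : ∀ S {T} → Atomic (S ⊕ T) → Atomic S × Atomic T
    Atomic-⊕⁻ (Γ , Δ) (is , js) =
      (All.++⁻ˡ Γ is , All.++⁻ˡ Δ js) , (All.++⁻ʳ Γ is , All.++⁻ʳ Δ js)

    Atomic-⊕⁺ : ∀ {S T} → Atomic S → Atomic T → Atomic (S ⊕ T)
    Atomic-⊕⁺ (is , js) (is′ , js′) = All.++⁺ is is′ , All.++⁺ js js′

    Atomic-single : ∀ l {F} → IsAtom F → Atomic (single l F)
    Atomic-single left  i = (i ∷ []) , []
    Atomic-single right i = [] , (i ∷ [])

    Atomic-single⁻ : ∀ l {F} → Atomic (single l F) → IsAtom F
    Atomic-single⁻ left  (i ∷ [] , _) = i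
    Atomic-single⁻ right (_ , i ∷ []) = i

    -- The excesses of `T′` and `U′` add up to that of `S`, as the two copies of `F` cancel, so they
    -- cannot both be negative. If `T′` is not true, its excess is at most 0 and that of `U′` is
    -- nonnegative. The case distinction is classical, hence the double negation.
    split-sound : ∀ l {F S} T U → IsAtom F → S ≈ˢ T ⊕ U → TrueAtomic S →
      ¬ ¬ Any TrueAtomic ((single l F ⊕ T) ∷ [ U ⊕ single (opposite l) F ])
    split-sound l {F} {S} T U i S≈T⊕U holds none with true⁻ holds
    ... | at , 0≤ with Atomic-⊕⁻ T (Atomic-≈ S≈T⊕U at)
    ...   | atT , atU = none (there (here (true⁺ (Atomic-⊕⁺ atU (Atomic-single (opposite l) i))
              (0≤+∧≤0⇒0≤ (excess T′) (excess U′) (0≤-cong {excess S} {excess T′ +ᴿ excess U′} S≐ 0≤)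
                (0≰⇒≤0 (excess T′) λ 0≤T′ →
                  none (here (true⁺ (Atomic-⊕⁺ (Atomic-single l i) atT) 0≤T′)))))))
      where
      T′ = single l F ⊕ T
      U′ = U ⊕ single (opposite l) F
      S≐ : ∀ n → seq (excess S) n ≡ seq (excess T′ +ᴿ excess U′) n
      S≐ n = begin
        seq (excess S) n
          ≡⟨ trans (excess-≈ {S} {T ⊕ U} S≈T⊕U n) (excess-⊕ T {U} n) ⟩
        t ℚ.+ u
          ≡⟨ sym (trans (cong (ℚ._+ (t ℚ.+ u)) (excess-opposite l F n)) (ℚ.+-identityˡ _)) ⟩
        (f ℚ.+ f′) ℚ.+ (t ℚ.+ u)
          ≡⟨ +-interchange f f′ t u ⟩
        (f ℚ.+ t) ℚ.+ (u ℚ.+ f′)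
          ≡⟨ sym (cong₂ ℚ._+_ (excess-⊕ (single l F) {T} n) (excess-⊕ U {single (opposite l) F} n)) ⟩
        seq (excess T′) n ℚ.+ seq (excess U′) n ∎
        where
        open ≡-Reasoning
        t  = seq (excess T) n
        u  = seq (excess U) n
        f  = seq (excess (single l F)) n
        f′ = seq (excess (single (opposite l) F)) n

  single⊕-nonatomic : ∀ {M ν l A Ps S T} → Rule l A Ps → S ≈ˢ single l (rpl A) ⊕ T →
    ¬ Semantics.TrueAtomic M ν S
  single⊕-nonatomic {M} {ν} {l} R S≈ holds = principal-compound R
    (Atomic-single⁻ M ν l (proj₁ (Atomic-⊕⁻ M ν (single l _)
      (Atomic-≈ M ν S≈ (proj₁ (true⁻ M ν holds))))))

  -- Replacing a sequent without increasing the height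

  exchangeᴰ : ∀ {n H H′} → H ≈ᴴ H′ → Derivable n H → Derivable n H′
  exchangeᴰ H≈H′ (axiom ax) = axiom λ M ν none →
    ax M ν (none ∘ H.Any-resp-↭ (TrueAtomic-≈ M ν) H≈H′)
  exchangeᴰ H≈H′ (infer R H≈ ds) = infer R (≈ᴴ-trans (≈ᴴ-sym H≈H′) H≈) ds

  weakenHeight : ∀ {m n H} → m ≤ n → Derivable m H → Derivable n H
  weakenHeight m≤n (axiom ax) = axiom ax
  weakenHeight (s≤s m≤n) (infer R H≈ ds) =
    infer R H≈ λ a P∈ → weakenHeight m≤n (ds a P∈)

  plug-cong : ∀ P {S T 𝒢 ℋ} → S ≈ˢ T → 𝒢 ≈ᴴ ℋ → plug P S 𝒢 ≈ᴴ plug P T ℋ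
  plug-cong (L , E) S≈T 𝒢≈ℋ = H.++⁺ˡ E (≈ᴴ-prep (⊕-congˡ S≈T) 𝒢≈ℋ)

  plug-++-[] : ∀ P {S 𝒢} → plug P S 𝒢 ≈ᴴ plug P S [] ++ 𝒢
  plug-++-[] (L , E) = ≈ᴴ-sym (H.++-assoc E _ _)

  plug-++ : ∀ P {S} E {𝒢} → plug P S (E ++ 𝒢) ≈ᴴ E ++ plug P S 𝒢
  plug-++ (L , X) E = ≈ᴴ-trans (H.++⁺ˡ X (≈ᴴ-sym (H.↭-shift E _))) (H.shifts X E)

  -- S ⇝ E: a sequent S of a derivable hypersequent may be replaced by E
  -- without increasing the height.  The formula F in split is arbitrary up to
  -- being an atom: in a true S, either T holds with F added on side l or U
  -- holds with F added on the other side.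
  data _⇝_ (S : Sequent) (E : Hypersequent) : Set where
    split : ∀ l {F T U} → IsAtom F → S ≈ˢ T ⊕ U →
      E ≈ᴴ (single l F ⊕ T) ∷ [ U ⊕ single (opposite l) F ] → S ⇝ E
    invert : ∀ {l A Ps a P T} {R : Rule l A Ps} → Invertible R → P ∈ Ps a →
      S ≈ˢ single l (rpl A) ⊕ T → E ≈ᴴ plug P T [] → S ⇝ E

  -- The case `invert` is vacuous: a sequent with a compound principal formula is not atomic, let
  -- alone true.
  ⇝-sound : ∀ {M ν S E} → S ⇝ E → Semantics.TrueAtomic M ν S →
    ¬ ¬ Any (Semantics.TrueAtomic M ν) E
  ⇝-sound {M} {ν} (split l {T = T} {U} i S≈ E≈) holds none =
    split-sound M ν l T U i S≈ holds
      (none ∘ H.Any-resp-↭ (TrueAtomic-≈ M ν) (≈ᴴ-sym E≈))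
  ⇝-sound (invert {R = R} _ _ S≈ _) holds _ = single⊕-nonatomic R S≈ holds

  -- Confronts the last rule of a derivation with a replacement of its principal sequent. If that
  -- very occurrence is being inverted, `E` is already one of the premises. Otherwise the principal
  -- formula survives in a sequent of `E`, and the replacement works equally with any `L` in its
  -- place, so it can be carried out in the premises.
  ⇝-step : ∀ {l A Ps S E} → Rule l A Ps → (single l (rpl A) ⊕ S) ⇝ E →
    (∃₂ λ a P → P ∈ Ps a × E ≈ᴴ plug P S []) ⊎
    (∃₂ λ T E′ → E ≈ᴴ (single l (rpl A) ⊕ T) ∷ E′ ×
                 ∀ L → (L ⊕ S) ⇝ ((L ⊕ T) ∷ E′))
  ⇝-step {l} R (split k {F} {T} {U} i S≈ E≈) with single⊕-⊕ l T S≈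
  ... | inj₁ (V , T≈ , S≈′) = inj₂
    ( single k F ⊕ V , [ U ⊕ single (opposite k) F ]
    , ≈ᴴ-trans E≈ (≈ᴴ-prep
        (≈ˢ-trans (⊕-congˡ {single k F} T≈) (x∙yz≈y∙xz (single k F) (single l _) V)) ≈ᴴ-refl)
    , λ L → split k i (≈ˢ-trans (⊕-congˡ {L} S≈′) (≈ˢ-sym (⊕-assoc L V U)))
        (≈ᴴ-prep (x∙yz≈y∙xz L (single k F) V) ≈ᴴ-refl) )
  ... | inj₂ (V , U≈ , S≈′) = inj₂
    ( V ⊕ single (opposite k) F , [ single k F ⊕ T ]
    , ≈ᴴ-trans E≈ (≈ᴴ-trans (≈ᴴ-swap _ _ ≈ᴴ-refl)
        (≈ᴴ-prep (≈ˢ-trans (⊕-congʳ U≈) (⊕-assoc (single l _) V (single (opposite k) F)))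
          ≈ᴴ-refl))
    , λ L → split k i (≈ˢ-trans (⊕-congˡ {L} S≈′) (x∙yz≈y∙xz L T V))
        (≈ᴴ-trans (≈ᴴ-prep (≈ˢ-sym (⊕-assoc L V (single (opposite k) F))) ≈ᴴ-refl)
          (≈ᴴ-swap _ _ ≈ᴴ-refl)) )
  ⇝-step {l} R (invert {k} {P = P} {T} I P∈ S≈ E≈) with single⊕-single⊕ l k S≈
  ... | inj₁ (refl , refl , S≈T) with invertible-unique I R
  ...   | refl = inj₁ (_ , P , P∈ , ≈ᴴ-trans E≈ (plug-cong P (≈ˢ-sym S≈T) ≈ᴴ-refl))
  ⇝-step {l} R (invert {k} {P = P@(L′ , X)} {T} I P∈ S≈ E≈) | inj₂ (V , S≈′ , T≈) = inj₂
    ( L′ ⊕ V , X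
    , ≈ᴴ-trans E≈ (rotate (≈ˢ-trans (⊕-congˡ {L′} T≈) (x∙yz≈y∙xz L′ (single l _) V)))
    , λ L → invert I P∈
        (≈ˢ-trans (⊕-congˡ {L} S≈′) (x∙yz≈y∙xz L (single k _) V))
        (≈ᴴ-sym (rotate (x∙yz≈y∙xz L′ L V))) )
    where
    rotate : ∀ {S T} → S ≈ˢ T → X ++ [ S ] ≈ᴴ T ∷ X
    rotate S≈T = ≈ᴴ-trans (H.++-comm X [ _ ]) (≈ᴴ-prep S≈T ≈ᴴ-refl)

  -- By induction on the derivation: the replacement moves up past the last rule until it reaches an
  -- axiom, where `⇝-sound` applies, or the rule that it inverts.
  replace : ∀ {n H S E 𝒢} → Derivable n H → H ≈ᴴ S ∷ 𝒢 → S ⇝ E → Derivable n (E ++ 𝒢)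
  replace {S = S} {E} {𝒢} (axiom ax) H≈ S⇝E = axiom λ M ν none → ax M ν λ any →
    replaced M ν none (H.Any-resp-↭ (TrueAtomic-≈ M ν) H≈ any)
    where
    replaced : ∀ M ν → let open Semantics M ν in
      ¬ Any TrueAtomic (E ++ 𝒢) → ¬ Any TrueAtomic (S ∷ 𝒢)
    replaced M ν none (here holds) = ⇝-sound S⇝E holds (none ∘ Any.++⁺ˡ)
    replaced M ν none (there any)  = none (Any.++⁺ʳ E any)
  replace {E = E} (infer {S = T} {𝒢 = ℋ} R H≈ ds) H≈′ S⇝E
    with ∷↭∷⁻ sequentSetoid (≈ᴴ-trans (≈ᴴ-sym H≈) H≈′)
  -- `S` is a side sequent of the last rule and recurs in all its premises.
  ... | inj₂ (𝒦 , ℋ≈ , 𝒢≈) = infer R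
    (≈ᴴ-trans (H.++⁺ˡ E 𝒢≈) (H.↭-shift E 𝒦))
    λ a {P} P∈ → exchangeᴰ (≈ᴴ-sym (plug-++ P E))
      (replace (ds a P∈) (≈ᴴ-trans (plug-cong P ≈ˢ-refl ℋ≈) (plug-++ P [ _ ])) S⇝E)
  ... | inj₁ (T≈S , ℋ≈𝒢) with ⇝-step R (⇝-cong (≈ˢ-sym T≈S) S⇝E)
    where
    ⇝-cong : ∀ {S T E} → S ≈ˢ T → S ⇝ E → T ⇝ E
    ⇝-cong S≈T (split l i S≈ E≈)   = split l i (≈ˢ-trans (≈ˢ-sym S≈T) S≈) E≈
    ⇝-cong S≈T (invert I P∈ S≈ E≈) = invert I P∈ (≈ˢ-trans (≈ˢ-sym S≈T) S≈) E≈
  -- The index `a` was fixed by the inversion; its premise is at hand because `Derivable` supplies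
  -- the premises for all indices.
  ...   | inj₁ (a , P , P∈ , E≈) = exchangeᴰ
          (≈ᴴ-trans (plug-++-[] P) (H.++⁺ (≈ᴴ-sym E≈) ℋ≈𝒢))
          (weakenHeight (ℕ.n≤1+n _) (ds a P∈))
  -- The rule is applied again to the sequent that inherits the principal formula.
  ...   | inj₂ (U , E′ , E≈ , L⊕T⇝) = infer R (H.++⁺ E≈ (≈ᴴ-sym ℋ≈𝒢))
          λ a {P} P∈ → exchangeᴰ (H.shifts (_ ∷ E′) (proj₂ P))
            (replace (ds a P∈) (H.↭-shift (proj₂ P) ℋ) (L⊕T⇝ (proj₁ P)))

  -- External contraction

  Contractible : ℕ → Set₁
  Contractible n = ∀ {S 𝒢} → Derivable n (S ∷ S ∷ 𝒢) → Derivable n (S ∷ 𝒢)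

  contract-++ : ∀ {n} → Contractible n → ∀ K {𝒢} →
    Derivable n (K ++ K ++ 𝒢) → Derivable n (K ++ 𝒢)
  contract-++ contr [] d = d
  contract-++ contr (S ∷ K) d = exchangeᴰ (H.↭-shift K _)
    (contract-++ contr K (exchangeᴰ
      (≈ᴴ-trans (≈ᴴ-sym (H.↭-shift K _)) (H.++⁺ˡ K (≈ᴴ-sym (H.↭-shift K _))))
      (contr (exchangeᴰ (≈ᴴ-prep ≈ˢ-refl (H.↭-shift K _)) d))))

  -- The part K of a premise is also obtained by replacing the conclusion.  Only
  -- for ∀⇒ and ⇒∃ is it a proper part: it then lacks the instance of the
  -- quantified formula.
  reduct : ∀ {l A Ps a P} → Rule l A Ps → P ∈ Ps a → ∀ S →
    ∃₂ λ K X → plug P S [] ≈ᴴ K ++ X × (single l (rpl A) ⊕ S) ⇝ K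
  reduct {l} {A} {P = P} R P∈ S = by-rule R P∈
    where
    Φ = single l (rpl A)

    invertible : ∀ {Ps a} {R : Rule l A Ps} → Invertible R → P ∈ Ps a →
      ∃₂ λ K X → plug P S [] ≈ᴴ K ++ X × (Φ ⊕ S) ⇝ K
    invertible I P∈ = plug P S [] , [] , ≈ᴴ-sym (H.++-identityʳ _) ,
      invert I P∈ ≈ˢ-refl ≈ᴴ-refl

    by-rule : ∀ {Ps a} → Rule l A Ps → P ∈ Ps a →
      ∃₂ λ K X → plug P S [] ≈ᴴ K ++ X × (Φ ⊕ S) ⇝ K
    by-rule →⇒ P∈ = invertible →⇒ P∈
    by-rule {a = a} ⇒→ P∈ = invertible {a = a} ⇒→ P∈
    by-rule ⇒∀ P∈ = invertible ⇒∀ P∈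
    by-rule ∃⇒ P∈ = invertible ∃⇒ P∈
    by-rule (∀⇒ t _) (here refl) = _ , [ _ ] , H.↭-reverse _ ,
      split left sp₁ (⊕-comm Φ S) ≈ᴴ-refl
    by-rule (⇒∃ t _) (here refl) = _ , [ _ ] , H.↭-reverse _ ,
      split right sp₀ (⊕-comm Φ S) ≈ᴴ-refl

  -- The copy of the conclusion kept beside the premise is replaced by a second copy of `K`, and the
  -- two copies of `K` are contracted at height `n`. This serves both the induction step of
  -- contraction and the removal of the conclusion from the cumulative premises of G¹.
  absorb : ∀ {n l A Ps a P S 𝒢} → Contractible n → Rule l A Ps → P ∈ Ps a →
    Derivable n (plug P S ((single l (rpl A) ⊕ S) ∷ 𝒢)) → Derivable n (plug P S 𝒢)
  absorb {P = P} {S} {𝒢} contr R P∈ d with reduct R P∈ S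
  ... | K , X , plug≈ , Φ⊕S⇝K = exchangeᴰ (≈ᴴ-sym plug≈′)
    (contract-++ contr K (exchangeᴰ (H.++⁺ˡ K plug≈′) (replace d (plug-++ P [ _ ]) Φ⊕S⇝K)))
    where
    plug≈′ : plug P S 𝒢 ≈ᴴ K ++ X ++ 𝒢
    plug≈′ = ≈ᴴ-trans (plug-++-[] P) (≈ᴴ-trans (H.++⁺ʳ 𝒢 plug≈) (H.++-assoc K X 𝒢))

  -- The recursion is on the height, not on the derivation: `absorb` contracts derivations made by
  -- `replace`, which are not subderivations.
  contract′ : ∀ n {H S 𝒢} → Derivable n H → H ≈ᴴ S ∷ S ∷ 𝒢 → Derivable n (S ∷ 𝒢)
  contract′ _ (axiom ax) H≈ = axiom λ M ν none → ax M ν λ any →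
    case H.Any-resp-↭ (TrueAtomic-≈ M ν) H≈ any of λ where
      (here holds)         → none (here holds)
      (there (here holds)) → none (here holds)
      (there (there any))  → none (there any)
  contract′ (suc n) {S = S} {𝒢} (infer {l = l} {A} {S = T} {ℋ} R H≈ ds) H≈′ =
    by-cases (∷↭∷⁻ sequentSetoid (≈ᴴ-trans (≈ᴴ-sym H≈) H≈′))
    where
    Φ = single l (rpl A)

    -- The last rule acts on one of the two copies; the other stays in each premise, where it is
    -- absorbed before the rule is applied again.
    principal : Φ ⊕ T ≈ˢ S → ℋ ≈ᴴ S ∷ 𝒢 → Derivable (suc n) (S ∷ 𝒢)
    principal Φ⊕T≈S ℋ≈ = infer R (≈ᴴ-prep (≈ˢ-sym Φ⊕T≈S) ≈ᴴ-refl) λ a {P} P∈ →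
      absorb (λ d → contract′ n d ≈ᴴ-refl) R P∈
        (exchangeᴰ (plug-cong P ≈ˢ-refl
          (≈ᴴ-trans ℋ≈ (≈ᴴ-prep (≈ˢ-sym Φ⊕T≈S) ≈ᴴ-refl))) (ds a P∈))

    by-cases : (Φ ⊕ T ≈ˢ S × ℋ ≈ᴴ S ∷ 𝒢) ⊎
               (∃ λ 𝒦 → ℋ ≈ᴴ S ∷ 𝒦 × S ∷ 𝒢 ≈ᴴ (Φ ⊕ T) ∷ 𝒦) →
               Derivable (suc n) (S ∷ 𝒢)
    by-cases (inj₁ (Φ⊕T≈S , ℋ≈)) = principal Φ⊕T≈S ℋ≈
    by-cases (inj₂ (𝒦 , ℋ≈ , S∷𝒢≈)) with ∷↭∷⁻ sequentSetoid S∷𝒢≈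
    ... | inj₁ (S≈Φ⊕T , 𝒢≈𝒦) =
      principal (≈ˢ-sym S≈Φ⊕T) (≈ᴴ-trans ℋ≈ (≈ᴴ-prep ≈ˢ-refl (≈ᴴ-sym 𝒢≈𝒦)))
    -- Both copies are side sequents, so they are contracted in the premises.
    ... | inj₂ (𝒥 , 𝒢≈ , 𝒦≈) = infer R
      (≈ᴴ-trans (≈ᴴ-prep ≈ˢ-refl 𝒢≈) (≈ᴴ-swap _ _ ≈ᴴ-refl))
      λ a {P} P∈ → exchangeᴰ (≈ᴴ-sym (plug-++ P [ S ]))
        (contract′ n (ds a P∈) (≈ᴴ-trans
          (plug-cong P ≈ˢ-refl (≈ᴴ-trans ℋ≈ (≈ᴴ-prep ≈ˢ-refl 𝒦≈)))
          (plug-++ P (S ∷ [ S ]))))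

  contract : ∀ n → Contractible n
  contract n d = contract′ n d ≈ᴴ-refl

  -- With `F` an instance of the quantified formula `G` and `s` the semipropositional variable, this
  -- turns a premise of `∀⇒` or `⇒∃` in G¹ into the corresponding one in G³. Splitting off `F` and
  -- `G` at the same `s` gives two equal sequents, which are contracted.
  instantiate : ∀ {n} l {F G s S 𝒢} → IsAtom s →
    Derivable n ((single l F ⊕ S) ∷ (single l G ⊕ S) ∷ 𝒢) →
    Derivable n ((single l F ⊕ single (opposite l) s) ∷ (single l G ⊕ single (opposite l) s)
                  ∷ (single l s ⊕ S) ∷ 𝒢)
  instantiate {n} l {F} {G} {s} {S} i d =
    exchangeᴰ (H.++⁺ʳ _ (H.↭-reverse (_ ∷ _ ∷ [ _ ])))
      (contract n (exchangeᴰ (≈ᴴ-prep ≈ˢ-refl (≈ᴴ-swap _ _ ≈ᴴ-refl))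
        (replace (replace d ≈ᴴ-refl (split-off F)) (H.↭-shift (_ ∷ [ _ ]) _) (split-off G))))
    where
    split-off : ∀ F → (single l F ⊕ S) ⇝
      ((single l s ⊕ S) ∷ [ single l F ⊕ single (opposite l) s ])
    split-off F = split l i (⊕-comm (single l F) S) ≈ᴴ-refl

  -- Fresh indices and the passage to G³

  fresh : (xs : List ℕ) → ∃ (_∉ xs)
  fresh xs = suc (max 0 xs) , λ m∈xs → ℕ.<-irrefl refl (All.lookup (xs≤max 0 xs) m∈xs)

  -- Ignores the kind of formula: a number outside all its values is fresh for both types of
  -- semipropositional variables.
  index : Formula → ℕ
  index (rpl _) = 0
  index (sp₁ p) = p
  index (sp₀ q) = q

  fresh-sp₁ : ∀ H → ∃ λ p → sp₁ p ∉ members H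
  fresh-sp₁ H with fresh (map index (members H))
  ... | p , p∉ = p , p∉ ∘ ∈-map⁺ index

  fresh-sp₀ : ∀ H → ∃ λ q → sp₀ q ∉ members H
  fresh-sp₀ H with fresh (map index (members H))
  ... | q , q∉ = q , q∉ ∘ ∈-map⁺ index

  -- Of the premises given for all indices, the one for a fresh index meets the side condition of
  -- the rule.
  toG³ : ∀ {n H} → Derivable n H → ProvableG³ H
  toG³ (axiom ax) = axiom ax
  toG³ (infer {A = A} {S = S} {𝒢} →⇒ H≈ ds)
    with fresh-sp₁ ((single left (rpl A) ⊕ S) ∷ 𝒢)
  ... | p , p∉ = exchange (≈ᴴ-sym H≈) (→⇒ p p∉ (toG³ (ds p (here refl))))
  toG³ (infer ⇒→ H≈ ds) = exchange (≈ᴴ-sym H≈)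
    (⇒→ (toG³ (ds 0 (here refl))) (toG³ (ds 0 (there (here refl)))))
  toG³ (infer {A = A} {S = S} {𝒢} (∀⇒ t closed) H≈ ds)
    with fresh-sp₁ ((single left (rpl A) ⊕ S) ∷ 𝒢)
  ... | p , p∉ = exchange (≈ᴴ-sym H≈) (∀⇒ p t p∉ closed (toG³ (ds p (here refl))))
  toG³ (infer {A = A} {S = S} {𝒢} ⇒∀ H≈ ds)
    with fresh (parameters ((single right (rpl A) ⊕ S) ∷ 𝒢))
  ... | a , a∉ = exchange (≈ᴴ-sym H≈) (⇒∀ a a∉ (toG³ (ds a (here refl))))
  toG³ (infer {A = A} {S = S} {𝒢} (⇒∃ t closed) H≈ ds)
    with fresh-sp₀ ((single right (rpl A) ⊕ S) ∷ 𝒢)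
  ... | q , q∉ = exchange (≈ᴴ-sym H≈) (⇒∃ q t q∉ closed (toG³ (ds q (here refl))))
  toG³ (infer {A = A} {S = S} {𝒢} ∃⇒ H≈ ds)
    with fresh (parameters ((single left (rpl A) ⊕ S) ∷ 𝒢))
  ... | a , a∉ = exchange (≈ᴴ-sym H≈) (∃⇒ a a∉ (toG³ (ds a (here refl))))

  -- Renaming parameters and semipropositional variables

  renameᵗ  : (Parameter → Parameter) → Term → Term
  renameᵗˢ : ∀ {n} → (Parameter → Parameter) → Vec Term n → Vec Term n
  renameᵗ f (var x)            = var x
  renameᵗ f (app (param a) ts) = app (param (f a)) ts
  renameᵗ f (app (func g) ts)  = app (func g) (renameᵗˢ f ts)
  renameᵗˢ f []       = []
  renameᵗˢ f (t ∷ ts) = renameᵗ f t ∷ renameᵗˢ f ts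

  renameᴿ : (Parameter → Parameter) → RPLFormula → RPLFormula
  renameᴿ f (atom P ts) = atom P (renameᵗˢ f ts)
  renameᴿ f (const r)   = const r
  renameᴿ f (A ⊃ B)     = renameᴿ f A ⊃ renameᴿ f B
  renameᴿ f (all x A)   = all x (renameᴿ f A)
  renameᴿ f (ex x A)    = ex x (renameᴿ f A)

  module _ (f g : ℕ → ℕ) where

    -- Type 0 variables stay fixed, since no rule of G¹ has one as its eigenvariable.
    renameᶠ : Formula → Formula
    renameᶠ (rpl A) = rpl (renameᴿ f A)
    renameᶠ (sp₁ p) = sp₁ (g p)
    renameᶠ (sp₀ q) = sp₀ q

    renameˢ : Sequent → Sequent
    renameˢ (Γ ⇒ Δ) = map renameᶠ Γ ⇒ map renameᶠ Δ

    rename : Hypersequent → Hypersequent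
    rename = map renameˢ

    rename-≈ : ∀ {H H′} → H ≈ᴴ H′ → rename H ≈ᴴ rename H′
    rename-≈ = H.map⁺ sequentSetoid λ (p , q) → Multisetₚ.map⁺ renameᶠ p , Multisetₚ.map⁺ renameᶠ q

  renameᵗ-[≔] : ∀ f t x u → renameᵗ f (t [ x ≔ u ]ᵗ) ≡ renameᵗ f t [ x ≔ renameᵗ f u ]ᵗ
  renameᵗˢ-[≔] : ∀ f {n} (ts : Vec Term n) x u →
    renameᵗˢ f (ts [ x ≔ u ]ᵗˢ) ≡ renameᵗˢ f ts [ x ≔ renameᵗ f u ]ᵗˢ
  renameᵗ-[≔] f (var y) x u with does (x ℕ.≟ y)
  ... | true  = refl
  ... | false = refl
  renameᵗ-[≔] f (app (param a) []) x u = refl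
  renameᵗ-[≔] f (app (func g) ts) x u = cong (app (func g)) (renameᵗˢ-[≔] f ts x u)
  renameᵗˢ-[≔] f [] x u = refl
  renameᵗˢ-[≔] f (t ∷ ts) x u = cong₂ _∷_ (renameᵗ-[≔] f t x u) (renameᵗˢ-[≔] f ts x u)

  renameᴿ-[≔] : ∀ f A x u → renameᴿ f (A [ x ≔ u ]) ≡ renameᴿ f A [ x ≔ renameᵗ f u ]
  renameᴿ-[≔] f (atom P ts) x u = cong (atom P) (renameᵗˢ-[≔] f ts x u)
  renameᴿ-[≔] f (const r) x u = refl
  renameᴿ-[≔] f (A ⊃ B) x u = cong₂ _⊃_ (renameᴿ-[≔] f A x u) (renameᴿ-[≔] f B x u)
  renameᴿ-[≔] f (all y A) x u with does (x ℕ.≟ y)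
  ... | true  = refl
  ... | false = cong (all y) (renameᴿ-[≔] f A x u)
  renameᴿ-[≔] f (ex y A) x u with does (x ℕ.≟ y)
  ... | true  = refl
  ... | false = cong (ex y) (renameᴿ-[≔] f A x u)

  variablesᵗ-rename : ∀ f t → variablesᵗ (renameᵗ f t) ≡ variablesᵗ t
  variablesᵗˢ-rename : ∀ f {n} (ts : Vec Term n) → variablesᵗˢ (renameᵗˢ f ts) ≡ variablesᵗˢ ts
  variablesᵗ-rename f (var x) = refl
  variablesᵗ-rename f (app (param a) []) = refl
  variablesᵗ-rename f (app (func g) ts) = variablesᵗˢ-rename f ts
  variablesᵗˢ-rename f [] = refl
  variablesᵗˢ-rename f (t ∷ ts) = cong₂ _++_ (variablesᵗ-rename f t) (variablesᵗˢ-rename f ts)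

  renameᵗ-closed : ∀ f t → Closed t → Closed (renameᵗ f t)
  renameᵗ-closed f t closed = trans (variablesᵗ-rename f t) closed

  renameᵗ-id : ∀ t → renameᵗ id t ≡ t
  renameᵗˢ-id : ∀ {n} (ts : Vec Term n) → renameᵗˢ id ts ≡ ts
  renameᵗ-id (var x) = refl
  renameᵗ-id (app (param a) ts) = refl
  renameᵗ-id (app (func g) ts) = cong (app (func g)) (renameᵗˢ-id ts)
  renameᵗˢ-id [] = refl
  renameᵗˢ-id (t ∷ ts) = cong₂ _∷_ (renameᵗ-id t) (renameᵗˢ-id ts)

  renameᴿ-id : ∀ A → renameᴿ id A ≡ A
  renameᴿ-id (atom P ts) = cong (atom P) (renameᵗˢ-id ts)
  renameᴿ-id (const r) = refl
  renameᴿ-id (A ⊃ B) = cong₂ _⊃_ (renameᴿ-id A) (renameᴿ-id B)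
  renameᴿ-id (all x A) = cong (all x) (renameᴿ-id A)
  renameᴿ-id (ex x A) = cong (ex x) (renameᴿ-id A)

  renameᶠ-id : ∀ F → renameᶠ id id F ≡ F
  renameᶠ-id (rpl A) = cong rpl (renameᴿ-id A)
  renameᶠ-id (sp₁ p) = refl
  renameᶠ-id (sp₀ q) = refl

  rename-id : ∀ H → rename id id H ≡ H
  rename-id [] = refl
  rename-id ((Γ ⇒ Δ) ∷ 𝒢) = cong₂ _∷_ (cong₂ _,_ (map-renameᶠ-id Γ) (map-renameᶠ-id Δ)) (rename-id 𝒢)
    where
    map-renameᶠ-id : ∀ Γ → map (renameᶠ id id) Γ ≡ Γ
    map-renameᶠ-id Γ = trans (List.map-cong renameᶠ-id Γ) (List.map-id Γ)

  infixl 9 _[_↦_]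

  _[_↦_] : (ℕ → ℕ) → ℕ → ℕ → ℕ → ℕ
  (f [ a ↦ b ]) c = if does (c ℕ.≟ a) then b else f c

  ↦-here : ∀ f a b → (f [ a ↦ b ]) a ≡ b
  ↦-here f a b rewrite dec-true (a ℕ.≟ a) refl = refl

  ↦-there : ∀ f {a c} b → c ≢ a → (f [ a ↦ b ]) c ≡ f c
  ↦-there f {a} {c} b c≢a rewrite dec-false (c ℕ.≟ a) c≢a = refl

  module _ {f : ℕ → ℕ} {a b : ℕ} where

    renameᵗ-fresh : ∀ t → a ∉ parametersᵗ t → renameᵗ (f [ a ↦ b ]) t ≡ renameᵗ f t
    renameᵗˢ-fresh : ∀ {n} (ts : Vec Term n) → a ∉ parametersᵗˢ ts →
      renameᵗˢ (f [ a ↦ b ]) ts ≡ renameᵗˢ f ts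
    renameᵗ-fresh (var x) a∉ = refl
    renameᵗ-fresh (app (param c) ts) a∉ =
      cong (λ d → app (param d) ts) (↦-there f b λ { refl → a∉ (here refl) })
    renameᵗ-fresh (app (func g) ts) a∉ = cong (app (func g)) (renameᵗˢ-fresh ts a∉)
    renameᵗˢ-fresh [] a∉ = refl
    renameᵗˢ-fresh (t ∷ ts) a∉ = cong₂ _∷_
      (renameᵗ-fresh t (a∉ ∘ ∈-++⁺ˡ)) (renameᵗˢ-fresh ts (a∉ ∘ ∈-++⁺ʳ (parametersᵗ t)))

    renameᴿ-fresh : ∀ A → a ∉ parametersᴿ A → renameᴿ (f [ a ↦ b ]) A ≡ renameᴿ f A
    renameᴿ-fresh (atom P ts) a∉ = cong (atom P) (renameᵗˢ-fresh ts a∉)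
    renameᴿ-fresh (const r) a∉ = refl
    renameᴿ-fresh (A ⊃ B) a∉ = cong₂ _⊃_
      (renameᴿ-fresh A (a∉ ∘ ∈-++⁺ˡ)) (renameᴿ-fresh B (a∉ ∘ ∈-++⁺ʳ (parametersᴿ A)))
    renameᴿ-fresh (all x A) a∉ = cong (all x) (renameᴿ-fresh A a∉)
    renameᴿ-fresh (ex x A) a∉ = cong (ex x) (renameᴿ-fresh A a∉)

  module _ {f g f′ g′ : ℕ → ℕ} where

    map-renameᶠ-cong : ∀ Γ → (∀ {F} → F ∈ Γ → renameᶠ f g F ≡ renameᶠ f′ g′ F) →
      map (renameᶠ f g) Γ ≡ map (renameᶠ f′ g′) Γ
    map-renameᶠ-cong Γ eq = List.map-cong-local (All.tabulate eq)

    rename-cong : ∀ H → (∀ {F} → F ∈ members H → renameᶠ f g F ≡ renameᶠ f′ g′ F) →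
      rename f g H ≡ rename f′ g′ H
    rename-cong [] eq = refl
    rename-cong ((Γ ⇒ Δ) ∷ 𝒢) eq = cong₂ _∷_
      (cong₂ _,_ (map-renameᶠ-cong Γ (eq ∘ ∈-++⁺ˡ ∘ ∈-++⁺ˡ))
                 (map-renameᶠ-cong Δ (eq ∘ ∈-++⁺ˡ ∘ ∈-++⁺ʳ Γ)))
      (rename-cong 𝒢 (eq ∘ ∈-++⁺ʳ (Γ ++ Δ)))

  rename-fresh-parameter : ∀ {f g a b} H → a ∉ parameters H →
    rename (f [ a ↦ b ]) g H ≡ rename f g H
  rename-fresh-parameter {f} {g} {a} {b} H a∉ = rename-cong H λ {F} F∈ →
    formula F (a∉ ∘ ∈-concatMap⁺ parametersᶠ ∘ λ a∈F → Any.map (λ { refl → a∈F }) F∈)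
    where
    formula : ∀ F → a ∉ parametersᶠ F → renameᶠ (f [ a ↦ b ]) g F ≡ renameᶠ f g F
    formula (rpl A) a∉ = cong rpl (renameᴿ-fresh A a∉)
    formula (sp₁ p) a∉ = refl
    formula (sp₀ q) a∉ = refl

  rename-fresh-sp₁ : ∀ {f g p r} H → sp₁ p ∉ members H →
    rename f (g [ p ↦ r ]) H ≡ rename f g H
  rename-fresh-sp₁ {f} {g} {p} {r} H p∉ = rename-cong H λ F∈ →
    formula _ λ { refl → p∉ F∈ }
    where
    formula : ∀ F → F ≢ sp₁ p → renameᶠ f (g [ p ↦ r ]) F ≡ renameᶠ f g F
    formula (rpl A) _ = refl
    formula (sp₁ s) s≢p = cong sp₁ (↦-there g r (s≢p ∘ cong sp₁))
    formula (sp₀ q) _ = refl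

  IsAtom-rename : ∀ {f g F} → IsAtom F → IsAtom (renameᶠ f g F)
  IsAtom-rename atom  = atom
  IsAtom-rename const = const
  IsAtom-rename sp₁   = sp₁
  IsAtom-rename sp₀   = sp₀

  module _ (f g : ℕ → ℕ) (M : HsInterpretation) (ν : Variable → HsInterpretation.Domain M) where
    open HsInterpretation M

    -- Pulling the interpretation back along the renaming gives each original atom the value of its
    -- renamed form in `M`. Hence any renaming, injective or not, preserves axioms.
    renamed : HsInterpretation
    renamed = record M
      { funᴹ = λ { (param a) → funᴹ (param (f a)) ; (func h) → funᴹ (func h) }
      ; sp₁ᴹ = λ p → sp₁ᴹ (g p) }

    private
      module M  = Semantics M ν
      module M′ = Semantics renamed ν

    ⟦⟧ᵗ-rename : ∀ t → M.⟦ renameᵗ f t ⟧ᵗ ≡ M′.⟦ t ⟧ᵗ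
    ⟦⟧ᵗˢ-rename : ∀ {n} (ts : Vec Term n) → M.⟦ renameᵗˢ f ts ⟧ᵗˢ ≡ M′.⟦ ts ⟧ᵗˢ
    ⟦⟧ᵗ-rename (var x) = refl
    ⟦⟧ᵗ-rename (app (param a) []) = refl
    ⟦⟧ᵗ-rename (app (func h) ts) = cong (funᴹ (func h)) (⟦⟧ᵗˢ-rename ts)
    ⟦⟧ᵗˢ-rename [] = refl
    ⟦⟧ᵗˢ-rename (t ∷ ts) = cong₂ _∷_ (⟦⟧ᵗ-rename t) (⟦⟧ᵗˢ-rename ts)

    value-rename : ∀ F n → seq (value renamed ν F) n ≡ seq (value M ν (renameᶠ f g F)) n
    value-rename (rpl (atom P ts)) n =
      cong (λ ds → seq (UnitReal.value (predᴹ P ds)) n) (sym (⟦⟧ᵗˢ-rename ts))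
    value-rename (rpl (const r)) n = refl
    value-rename (rpl (A ⊃ B)) n = refl
    value-rename (rpl (all x A)) n = refl
    value-rename (rpl (ex x A)) n = refl
    value-rename (sp₁ p) n = refl
    value-rename (sp₀ q) n = refl

    weight-rename : ∀ Γ n →
      seq (weight renamed ν Γ) n ≡ seq (weight M ν (map (renameᶠ f g) Γ)) n
    weight-rename [] n = refl
    weight-rename (F ∷ Γ) n =
      cong₂ (λ x y → (x ℚ.- 1ℚ) ℚ.+ y) (value-rename F n) (weight-rename Γ n)

    TrueAtomic-rename : ∀ {S} → M′.TrueAtomic S → M.TrueAtomic (renameˢ f g S)
    TrueAtomic-rename {Γ ⇒ Δ} holds with true⁻ renamed ν holds
    ... | (is , js) , 0≤ = true⁺ M ν
      (All.map⁺ (All.map IsAtom-rename is) , All.map⁺ (All.map IsAtom-rename js))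
      (0≤-cong {excess renamed ν (Γ ⇒ Δ)} {excess M ν (renameˢ f g (Γ ⇒ Δ))}
        (λ n → cong₂ ℚ._-_ (weight-rename Δ n) (weight-rename Γ n)) 0≤)

  IsAxiom-rename : ∀ {f g H} → IsAxiom H → IsAxiom (rename f g H)
  IsAxiom-rename {f} {g} ax M ν none = ax (renamed f g M ν) ν
    (none ∘ Any.map⁺ ∘ Any.map (TrueAtomic-rename f g M ν))

  -- Translating proofs of G¹

  all-injective : ∀ {x A B} → rpl (all x A) ≡ rpl (all x B) → A ≡ B
  all-injective refl = refl

  ex-injective : ∀ {x A B} → rpl (ex x A) ≡ rpl (ex x B) → A ≡ B
  ex-injective refl = refl

  -- Freshness is exploited once, as an equation between renamed conclusions; from it the equations
  -- for the principal formula and the contexts are recovered for use in the premise.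
  left-injective : ∀ {F F′ Γ Γ′ Δ Δ′} {𝒢 𝒢′ : Hypersequent} →
    (F ∷ Γ , Δ) ∷ 𝒢 ≡ (F′ ∷ Γ′ , Δ′) ∷ 𝒢′ → F ≡ F′ × Γ ≡ Γ′ × Δ ≡ Δ′
  left-injective refl = refl , refl , refl

  right-injective : ∀ {F F′ Γ Γ′ Δ Δ′} {𝒢 𝒢′ : Hypersequent} →
    (Γ , F ∷ Δ) ∷ 𝒢 ≡ (Γ′ , F′ ∷ Δ′) ∷ 𝒢′ → F ≡ F′ × Γ ≡ Γ′ × Δ ≡ Δ′
  right-injective refl = refl , refl , refl

  -- Renaming commutes with substitution and sends the eigenparameter `a` to `b`.
  rename-eigenformula : ∀ {f A A′} x a b → renameᴿ (f [ a ↦ b ]) A ≡ A′ →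
    renameᴿ (f [ a ↦ b ]) (A [ x ≔ parameter a ]) ≡ A′ [ x ≔ parameter b ]
  rename-eigenformula {f} {A} x a b eq = trans (renameᴿ-[≔] _ A x (parameter a))
    (cong₂ (λ B c → B [ x ≔ parameter c ]) eq (↦-here f a b))

  -- Renaming turns the premise for one fresh eigenvariable into the premises
  -- for all eigenvariables that Derivable asks for.
  fromG¹ : ∀ {H} → ProvableG¹ H → ∃ λ n → ∀ f g → Derivable n (rename f g H)
  fromG¹ (axiom _ ax) = 0 , λ f g → axiom (IsAxiom-rename ax)
  fromG¹ (exchange H≈ d) with fromG¹ d
  ... | n , ih = n , λ f g → exchangeᴰ (rename-≈ f g H≈) (ih f g)
  fromG¹ (→⇒ {𝒢} {Γ} {Δ} {A} {B} p p∉ d) with fromG¹ d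
  ... | n , ih = suc n , λ f g → infer →⇒ ≈ᴴ-refl λ { r (here refl) →
    -- The requested variable `r` is obtained by sending `p` to it in the induction hypothesis; as
    -- `p` is fresh, the conclusion is renamed as by `g`.
    let eq = rename-fresh-sp₁ {f} {g} {p} {r} ((rpl (A ⊃ B) ∷ Γ ⇒ Δ) ∷ 𝒢) p∉
        _ , Γ≡ , Δ≡ = left-injective eq
        p↦r = cong sp₁ (↦-here g p r)
    in absorb (contract n) →⇒ (here refl) (subst (Derivable n)
      (cong₂ _∷_ (cong (λ F → [ rpl (renameᴿ f B) ] ⇒ F ∷ [ rpl (renameᴿ f A) ]) p↦r)
        (cong₂ _∷_ (cong₂ _,_ (cong₂ _∷_ p↦r Γ≡) Δ≡) eq))
      (ih f (g [ p ↦ r ]))) }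
  fromG¹ (⇒→ d e) with fromG¹ d | fromG¹ e
  ... | m , ih | n , ih′ = suc (m ⊔ n) , λ f g → infer ⇒→ ≈ᴴ-refl λ where
    a (here refl) → absorb {a = a} (contract _) ⇒→ (here refl)
      (weakenHeight (ℕ.m≤m⊔n m n) (ih f g))
    a (there (here refl)) → absorb {a = a} (contract _) ⇒→ (there (here refl))
      (weakenHeight (ℕ.m≤n⊔m m n) (ih′ f g))
  fromG¹ (∀⇒ {x = x} {A} t closed d) with fromG¹ d
  ... | n , ih = suc n , λ f g →
    infer (∀⇒ (renameᵗ f t) (renameᵗ-closed f t closed)) ≈ᴴ-refl λ { p (here refl) →
      -- The cumulative premise holds both the instance and the quantified formula in the same
      -- context, as `instantiate` requires.
      instantiate left sp₁ (subst (λ B → Derivable n ((rpl B ∷ _ , _) ∷ _))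
        (renameᴿ-[≔] f A x t) (ih f g)) }
  fromG¹ (⇒∀ {𝒢} {Γ} {Δ} {x} {A} a a∉ d) with fromG¹ d
  ... | n , ih = suc n , λ f g → infer ⇒∀ ≈ᴴ-refl λ { b (here refl) →
    let eq = rename-fresh-parameter {f} {g} {a} {b} ((Γ ⇒ rpl (all x A) ∷ Δ) ∷ 𝒢) a∉
        A≡ , Γ≡ , Δ≡ = right-injective eq
        A[a]≡ = cong rpl (rename-eigenformula x a b (all-injective A≡))
    in absorb (contract n) ⇒∀ (here refl) (subst (Derivable n)
      (cong₂ _∷_ (cong₂ _,_ Γ≡ (cong₂ _∷_ A[a]≡ Δ≡)) eq)
      (ih (f [ a ↦ b ]) g)) }
  fromG¹ (⇒∃ {x = x} {A} t closed d) with fromG¹ d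
  ... | n , ih = suc n , λ f g →
    infer (⇒∃ (renameᵗ f t) (renameᵗ-closed f t closed)) ≈ᴴ-refl λ { q (here refl) →
      instantiate right sp₀ (subst (λ B → Derivable n ((_ , rpl B ∷ _) ∷ _))
        (renameᴿ-[≔] f A x t) (ih f g)) }
  fromG¹ (∃⇒ {𝒢} {Γ} {Δ} {x} {A} a a∉ d) with fromG¹ d
  ... | n , ih = suc n , λ f g → infer ∃⇒ ≈ᴴ-refl λ { b (here refl) →
    let eq = rename-fresh-parameter {f} {g} {a} {b} ((rpl (ex x A) ∷ Γ ⇒ Δ) ∷ 𝒢) a∉
        A≡ , Γ≡ , Δ≡ = left-injective eq
        A[a]≡ = cong rpl (rename-eigenformula x a b (ex-injective A≡))
    in absorb (contract n) ∃⇒ (here refl) (subst (Derivable n)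
      (cong₂ _∷_ (cong₂ _,_ (cong₂ _∷_ A[a]≡ Γ≡) Δ≡) eq)
      (ih (f [ a ↦ b ]) g)) }

  G¹⇒G³ : ∀ {H} → ProvableG¹ H → ProvableG³ H
  G¹⇒G³ {H} d with fromG¹ d
  ... | n , ih = toG³ (subst (Derivable n) (rename-id H) (ih id id))

theorem2 : (𝒮 : Signature) (H : Calculus.Hypersequent 𝒮) →
    Calculus.IsG¹Hypersequent 𝒮 H →
    Calculus.ProvableG¹ 𝒮 H → Calculus.ProvableG³ 𝒮 H
theorem2 𝒮 H _ = Translation.G¹⇒G³ 𝒮
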